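{- For every integer $i\ge 1$, there exist two irregular bipartite graphs $D_i$ and $D_i'$ that have the same spectrum, the same degree sequences and the same girth $6$, such that each of them has exactly one cycle of length $6$, and for every even integer $k$ with $6<k\le 2i+10$ the number of $k$-cycles in $D_i$ is different from the number of $k$-cycles in $D_i'$.
   Context: All graphs are finite, simple and undirected, and may be disconnected. The spectrum of a graph is the multiset of eigenvalues of its adjacency matrix. The degree sequences of a bipartite graph are the two monotonic non-increasing sequences of the node degrees on the two sides of a bipartition; two graphs have the same degree sequences if these coincide for suitable bipartitions. A bipartite graph is bi-regular if all nodes on the same side have the same degree, and irregular if it is not bi-regular. A $k$-cycle is a cycle of length $k$, cycles being counted as subgraphs. The girth is the length of a shortest cycle. -}

module Defs where

open import Algebra.Bundles using (CommutativeRing)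
open import Data.Bool using (Bool; true; false; if_then_else_)
import Data.Bool.Properties as 𝔹
open import Data.Fin using (Fin; toℕ)
open import Data.List using (List; length; map; filter; allFin)
open import Data.Nat using (ℕ; suc; _⊔_) renaming (_≤_ to _≤ⁿ_)
import Data.Nat.Properties as ℕ
open import Data.Product using (Σ-syntax; ∃; ∃-syntax; ∃₂; _×_; _,_)
open import Data.Rational using (ℚ; 0ℚ; 1ℚ; ½; ∣_∣; _<_; 1/_; NonZero; Positive; positive; nonNegative)
  renaming (_+_ to _+q_; _*_ to _*q_; -_ to -q_; _-_ to _-q_)
import Data.Rational.Properties as ℚ
open import Data.Rational.Solver using (module +-*-Solver)
open import Data.Sum using (_⊎_)
open import Data.Vec.Functional using (Vector)
open import Function using (_⇔_; _∘_)
open import Function.Bundles using (Inverse; mk⇔; module Equivalence)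
open import Function.Definitions using (Injective)
open import Level using (0ℓ)
open import Relation.Binary.Bundles using (Setoid)
open import Relation.Binary.PropositionalEquality
  using (_≡_; _≢_; refl; sym; trans; cong; subst; setoid)
open import Relation.Nullary using (¬_)

-- Real numbers: Cauchy sequences of rationals, with two sequences equal
-- when their difference tends to 0.
Close : (ℕ → ℚ) → (ℕ → ℚ) → Set
Close f g = ∀ ε → 0ℚ < ε → ∃[ N ] (∀ n → N ≤ⁿ n → ∣ f n -q g n ∣ < ε)

Cauchy : (ℕ → ℚ) → Set
Cauchy f = ∀ ε → 0ℚ < ε → ∃[ N ] (∀ m n → N ≤ⁿ m → N ≤ⁿ n → ∣ f m -q f n ∣ < ε)

record ℝ : Set where
  no-eta-equality
  field
    seq    : ℕ → ℚ
    cauchy : Cauchy seq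

open ℝ public

infix 4 _≈ᴿ_
record _≈ᴿ_ (x y : ℝ) : Set where
  constructor mk≈
  field
    close : Close (seq x) (seq y)

open _≈ᴿ_ public

private
  halve : ∀ ε → 0ℚ < ε → ∃[ δ ] (0ℚ < δ × δ +q δ ≡ ε)
  halve ε 0<ε = ½ *q ε , subst (_< ½ *q ε) (ℚ.*-zeroʳ ½) (ℚ.*-monoʳ-<-pos ½ 0<ε) ,
    trans (sym (ℚ.*-distribʳ-+ ε ½ ½)) (ℚ.*-identityˡ ε)

  divide : ∀ B ε → 0ℚ < B → 0ℚ < ε → ∃[ δ ] (0ℚ < δ × B *q δ ≡ ε)
  divide B ε 0<B 0<ε = B⁻¹ *q ε ,
      subst (_< B⁻¹ *q ε) (ℚ.*-zeroʳ B⁻¹) (ℚ.*-monoʳ-<-pos B⁻¹ 0<ε) ,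
      trans (sym (ℚ.*-assoc B B⁻¹ ε)) (trans (cong (_*q ε) (ℚ.*-inverseʳ B)) (ℚ.*-identityˡ ε))
    where
    instance
      B-pos : Positive B
      B-pos = positive 0<B
      B-nz : NonZero B
      B-nz = ℚ.pos⇒nonZero B
    B⁻¹ : ℚ
    B⁻¹ = 1/ B
    instance
      B⁻¹-pos : Positive B⁻¹
      B⁻¹-pos = ℚ.1/pos⇒pos B

  ∣+∣< : ∀ p q {δ ε} → ∣ p ∣ < δ → ∣ q ∣ < δ → δ +q δ ≡ ε → ∣ p +q q ∣ < ε
  ∣+∣< p q p<δ q<δ refl = ℚ.≤-<-trans (ℚ.∣p+q∣≤∣p∣+∣q∣ p q) (ℚ.+-mono-< p<δ q<δ)

  ∣*∣< : ∀ p q {B δ ε} → 0ℚ < B → ∣ p ∣ < B → ∣ q ∣ < δ → B *q δ ≡ ε → ∣ p *q q ∣ < ε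
  ∣*∣< p q {B} {δ} 0<B p<B q<δ refl = subst (_< B *q δ) (sym (ℚ.∣p*q∣≡∣p∣*∣q∣ p q))
    (ℚ.≤-<-trans
      (ℚ.*-monoʳ-≤-nonNeg ∣ q ∣ {{nonNegative (ℚ.0≤∣p∣ q)}} (ℚ.<⇒≤ p<B))
      (ℚ.*-monoʳ-<-pos B {{positive 0<B}} q<δ))

  ⊔ˡ : ∀ {a b n} → a ⊔ b ≤ⁿ n → a ≤ⁿ n
  ⊔ˡ {a} {b} = ℕ.≤-trans (ℕ.m≤m⊔n a b)

  ⊔ʳ : ∀ {a b n} → a ⊔ b ≤ⁿ n → b ≤ⁿ n
  ⊔ʳ {a} {b} = ℕ.≤-trans (ℕ.m≤n⊔m a b)

  0<1 : 0ℚ < 1ℚ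
  0<1 = ℚ.positive⁻¹ 1ℚ

  bounded : ∀ {f} → Cauchy f → ∃₂ λ B N → 0ℚ < B × (∀ n → N ≤ⁿ n → ∣ f n ∣ < B)
  bounded {f} f-cauchy = let (N , close) = f-cauchy 1ℚ 0<1 in
    1ℚ +q ∣ f N ∣ , N ,
    ℚ.+-mono-<-≤ 0<1 (ℚ.0≤∣p∣ (f N)) ,
    λ n N≤n → subst (λ q → ∣ q ∣ < 1ℚ +q ∣ f N ∣)
      (solve 2 (λ a b → (a :- b) :+ b := a) refl (f n) (f N))
      (ℚ.≤-<-trans (ℚ.∣p+q∣≤∣p∣+∣q∣ (f n -q f N) (f N))
        (ℚ.+-monoˡ-< ∣ f N ∣ (close n N N≤n ℕ.≤-refl)))
    where open +-*-Solver

  +-diff : ∀ a b c d → (a -q c) +q (b -q d) ≡ (a +q b) -q (c +q d)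
  +-diff = solve 4 (λ a b c d → (a :- c) :+ (b :- d) := (a :+ b) :- (c :+ d)) refl
    where open +-*-Solver

  *-diff : ∀ a b c d → a *q (b -q d) +q d *q (a -q c) ≡ a *q b -q c *q d
  *-diff = solve 4 (λ a b c d → a :* (b :- d) :+ d :* (a :- c) := a :* b :- c :* d) refl
    where open +-*-Solver

  neg-diff : ∀ a b → -q (a -q b) ≡ (-q a) -q (-q b)
  neg-diff = solve 2 (λ a b → :- (a :- b) := (:- a) :- (:- b)) refl
    where open +-*-Solver

  swap-diff : ∀ a b → -q (a -q b) ≡ b -q a
  swap-diff = solve 2 (λ a b → :- (a :- b) := b :- a) refl
    where open +-*-Solver

  trans-diff : ∀ a b c → (a -q b) +q (b -q c) ≡ a -q c
  trans-diff = solve 3 (λ a b c → (a :- b) :+ (b :- c) := a :- c) refl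
    where open +-*-Solver

  ∣-∣< : ∀ p {q ε} → -q p ≡ q → ∣ p ∣ < ε → ∣ q ∣ < ε
  ∣-∣< p {ε = ε} refl = subst (_< ε) (sym (ℚ.∣-p∣≡∣p∣ p))

  +-step : ∀ a b c d {δ ε} → ∣ a -q c ∣ < δ → ∣ b -q d ∣ < δ → δ +q δ ≡ ε →
    ∣ (a +q b) -q (c +q d) ∣ < ε
  +-step a b c d {ε = ε} p q eq =
    subst (λ r → ∣ r ∣ < ε) (+-diff a b c d) (∣+∣< (a -q c) (b -q d) p q eq)

  *-step : ∀ a b c d {A B α β δ ε} → 0ℚ < A → 0ℚ < B → ∣ a ∣ < A → ∣ d ∣ < B →
    ∣ b -q d ∣ < α → ∣ a -q c ∣ < β → A *q α ≡ δ → B *q β ≡ δ → δ +q δ ≡ ε →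
    ∣ (a *q b) -q (c *q d) ∣ < ε
  *-step a b c d {ε = ε} 0<A 0<B a<A d<B p q eqA eqB eq =
    subst (λ r → ∣ r ∣ < ε) (*-diff a b c d)
      (∣+∣< (a *q (b -q d)) (d *q (a -q c))
        (∣*∣< a (b -q d) 0<A a<A p eqA) (∣*∣< d (a -q c) 0<B d<B q eqB) eq)

  neg-step : ∀ a b {ε} → ∣ a -q b ∣ < ε → ∣ (-q a) -q (-q b) ∣ < ε
  neg-step a b = ∣-∣< (a -q b) (neg-diff a b)

  sym-step : ∀ a b {ε} → ∣ a -q b ∣ < ε → ∣ b -q a ∣ < ε
  sym-step a b = ∣-∣< (a -q b) (swap-diff a b)

  trans-step : ∀ a b c {δ ε} → ∣ a -q b ∣ < δ → ∣ b -q c ∣ < δ → δ +q δ ≡ ε → ∣ a -q c ∣ < ε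
  trans-step a b c {ε = ε} p q eq =
    subst (λ r → ∣ r ∣ < ε) (trans-diff a b c) (∣+∣< (a -q b) (b -q c) p q eq)

  ∣self∣< : ∀ p {ε} → 0ℚ < ε → ∣ p -q p ∣ < ε
  ∣self∣< p {ε} = subst (λ q → ∣ q ∣ < ε) (sym (ℚ.+-inverseʳ p))

  pointwise : ∀ x y → (∀ n → seq x n ≡ seq y n) → x ≈ᴿ y
  pointwise x y eq = mk≈ λ ε 0<ε → 0 , λ n _ →
    subst (λ q → ∣ seq x n -q q ∣ < ε) (eq n) (∣self∣< (seq x n) 0<ε)

fromℚ : ℚ → ℝ
fromℚ p .seq _ = p
fromℚ p .cauchy ε 0<ε = 0 , λ _ _ _ _ → ∣self∣< p 0<ε

0ℝ 1ℝ : ℝ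
0ℝ = fromℚ 0ℚ
1ℝ = fromℚ 1ℚ

infixl 6 _+ᴿ_
infixl 7 _*ᴿ_
infix  8 -ᴿ_

_+ᴿ_ : ℝ → ℝ → ℝ
(x +ᴿ y) .seq n = seq x n +q seq y n
(x +ᴿ y) .cauchy ε 0<ε =
    let (δ , 0<δ , δ+δ≡ε) = halve ε 0<ε
        (M , f) = cauchy x δ 0<δ
        (N , g) = cauchy y δ 0<δ
    in M ⊔ N , λ m n m≥ n≥ → +-step (seq x m) (seq y m) (seq x n) (seq y n)
      (f m n (⊔ˡ m≥) (⊔ˡ n≥)) (g m n (⊔ʳ {M} m≥) (⊔ʳ {M} n≥)) δ+δ≡ε

-ᴿ_ : ℝ → ℝ
(-ᴿ x) .seq n = -q seq x n
(-ᴿ x) .cauchy ε 0<ε = let (N , f) = cauchy x ε 0<ε in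
    N , λ m n m≥ n≥ → neg-step (seq x m) (seq x n) (f m n m≥ n≥)

_*ᴿ_ : ℝ → ℝ → ℝ
(x *ᴿ y) .seq n = seq x n *q seq y n
(x *ᴿ y) .cauchy ε 0<ε =
    let (δ , 0<δ , δ+δ≡ε)   = halve ε 0<ε
        (A , K , 0<A , x<A) = bounded (cauchy x)
        (B , L , 0<B , y<B) = bounded (cauchy y)
        (α , 0<α , Aα≡δ)    = divide A δ 0<A 0<δ
        (β , 0<β , Bβ≡δ)    = divide B δ 0<B 0<δ
        (M , g)             = cauchy y α 0<α
        (N , f)             = cauchy x β 0<β
    in (K ⊔ L) ⊔ (M ⊔ N) , λ m n m≥ n≥ → *-step (seq x m) (seq y m) (seq x n) (seq y n) 0<A 0<B
      (x<A m (⊔ˡ (⊔ˡ m≥))) (y<B n (⊔ʳ {K} (⊔ˡ n≥)))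
      (g m n (⊔ˡ (⊔ʳ {K ⊔ L} m≥)) (⊔ˡ (⊔ʳ {K ⊔ L} n≥)))
      (f m n (⊔ʳ {M} (⊔ʳ {K ⊔ L} m≥)) (⊔ʳ {M} (⊔ʳ {K ⊔ L} n≥)))
      Aα≡δ Bβ≡δ δ+δ≡ε

private
  ≈-refl : ∀ {x} → x ≈ᴿ x
  ≈-refl {x} = pointwise x x λ _ → refl

  ≈-sym : ∀ {x y} → x ≈ᴿ y → y ≈ᴿ x
  ≈-sym {x} {y} x≈y = mk≈ λ ε 0<ε → let (N , f) = close x≈y ε 0<ε in
    N , λ n n≥ → sym-step (seq x n) (seq y n) (f n n≥)

  ≈-trans : ∀ {x y z} → x ≈ᴿ y → y ≈ᴿ z → x ≈ᴿ z
  ≈-trans {x} {y} {z} x≈y y≈z = mk≈ λ ε 0<ε →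
    let (δ , 0<δ , δ+δ≡ε) = halve ε 0<ε
        (M , f) = close x≈y δ 0<δ
        (N , g) = close y≈z δ 0<δ
    in M ⊔ N , λ n n≥ →
      trans-step (seq x n) (seq y n) (seq z n)
        (f n (⊔ˡ n≥)) (g n (⊔ʳ {M} n≥)) δ+δ≡ε

  +-cong : ∀ {x u y v} → x ≈ᴿ u → y ≈ᴿ v → x +ᴿ y ≈ᴿ u +ᴿ v
  +-cong {x} {u} {y} {v} x≈u y≈v = mk≈ λ ε 0<ε →
    let (δ , 0<δ , δ+δ≡ε) = halve ε 0<ε
        (M , f) = close x≈u δ 0<δ
        (N , g) = close y≈v δ 0<δ
    in M ⊔ N , λ n n≥ →
      +-step (seq x n) (seq y n) (seq u n) (seq v n)
        (f n (⊔ˡ n≥)) (g n (⊔ʳ {M} n≥)) δ+δ≡ε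

  -‿cong : ∀ {x y} → x ≈ᴿ y → -ᴿ x ≈ᴿ -ᴿ y
  -‿cong {x} {y} x≈y = mk≈ λ ε 0<ε → let (N , f) = close x≈y ε 0<ε in
    N , λ n n≥ → neg-step (seq x n) (seq y n) (f n n≥)

  *-cong : ∀ {x u y v} → x ≈ᴿ u → y ≈ᴿ v → x *ᴿ y ≈ᴿ u *ᴿ v
  *-cong {x} {u} {y} {v} x≈u y≈v = mk≈ λ ε 0<ε →
    let (δ , 0<δ , δ+δ≡ε)   = halve ε 0<ε
        (A , K , 0<A , x<A) = bounded (cauchy x)
        (B , L , 0<B , v<B) = bounded (cauchy v)
        (α , 0<α , Aα≡δ)    = divide A δ 0<A 0<δ
        (β , 0<β , Bβ≡δ)    = divide B δ 0<B 0<δ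
        (M , g)             = close y≈v α 0<α
        (N , f)             = close x≈u β 0<β
    in (K ⊔ L) ⊔ (M ⊔ N) , λ n n≥ →
      *-step (seq x n) (seq y n) (seq u n) (seq v n) 0<A 0<B
        (x<A n (⊔ˡ (⊔ˡ n≥))) (v<B n (⊔ʳ {K} (⊔ˡ n≥)))
        (g n (⊔ˡ (⊔ʳ {K ⊔ L} n≥))) (f n (⊔ʳ {M} (⊔ʳ {K ⊔ L} n≥)))
        Aα≡δ Bβ≡δ δ+δ≡ε

  +-assoc : ∀ x y z → (x +ᴿ y) +ᴿ z ≈ᴿ x +ᴿ (y +ᴿ z)
  +-assoc x y z = pointwise ((x +ᴿ y) +ᴿ z) (x +ᴿ (y +ᴿ z)) λ n → ℚ.+-assoc (seq x n) (seq y n) (seq z n)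

  +-identityˡ : ∀ x → 0ℝ +ᴿ x ≈ᴿ x
  +-identityˡ x = pointwise (0ℝ +ᴿ x) (x) λ n → ℚ.+-identityˡ (seq x n)

  +-identityʳ : ∀ x → x +ᴿ 0ℝ ≈ᴿ x
  +-identityʳ x = pointwise (x +ᴿ 0ℝ) (x) λ n → ℚ.+-identityʳ (seq x n)

  +-inverseˡ : ∀ x → (-ᴿ x) +ᴿ x ≈ᴿ 0ℝ
  +-inverseˡ x = pointwise ((-ᴿ x) +ᴿ x) (0ℝ) λ n → ℚ.+-inverseˡ (seq x n)

  +-inverseʳ : ∀ x → x +ᴿ (-ᴿ x) ≈ᴿ 0ℝ
  +-inverseʳ x = pointwise (x +ᴿ (-ᴿ x)) (0ℝ) λ n → ℚ.+-inverseʳ (seq x n)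

  +-comm : ∀ x y → x +ᴿ y ≈ᴿ y +ᴿ x
  +-comm x y = pointwise (x +ᴿ y) (y +ᴿ x) λ n → ℚ.+-comm (seq x n) (seq y n)

  *-assoc : ∀ x y z → (x *ᴿ y) *ᴿ z ≈ᴿ x *ᴿ (y *ᴿ z)
  *-assoc x y z = pointwise ((x *ᴿ y) *ᴿ z) (x *ᴿ (y *ᴿ z)) λ n → ℚ.*-assoc (seq x n) (seq y n) (seq z n)

  *-identityˡ : ∀ x → 1ℝ *ᴿ x ≈ᴿ x
  *-identityˡ x = pointwise (1ℝ *ᴿ x) (x) λ n → ℚ.*-identityˡ (seq x n)

  *-identityʳ : ∀ x → x *ᴿ 1ℝ ≈ᴿ x
  *-identityʳ x = pointwise (x *ᴿ 1ℝ) (x) λ n → ℚ.*-identityʳ (seq x n)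

  *-distribˡ-+ : ∀ x y z → x *ᴿ (y +ᴿ z) ≈ᴿ (x *ᴿ y) +ᴿ (x *ᴿ z)
  *-distribˡ-+ x y z = pointwise (x *ᴿ (y +ᴿ z)) ((x *ᴿ y) +ᴿ (x *ᴿ z)) λ n → ℚ.*-distribˡ-+ (seq x n) (seq y n) (seq z n)

  *-distribʳ-+ : ∀ x y z → (y +ᴿ z) *ᴿ x ≈ᴿ (y *ᴿ x) +ᴿ (z *ᴿ x)
  *-distribʳ-+ x y z = pointwise ((y +ᴿ z) *ᴿ x) ((y *ᴿ x) +ᴿ (z *ᴿ x)) λ n → ℚ.*-distribʳ-+ (seq x n) (seq y n) (seq z n)

  *-comm : ∀ x y → x *ᴿ y ≈ᴿ y *ᴿ x
  *-comm x y = pointwise (x *ᴿ y) (y *ᴿ x) λ n → ℚ.*-comm (seq x n) (seq y n)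

ℝ-commutativeRing : CommutativeRing 0ℓ 0ℓ
ℝ-commutativeRing = record
  { Carrier = ℝ ; _≈_ = _≈ᴿ_ ; _+_ = _+ᴿ_ ; _*_ = _*ᴿ_ ; -_ = -ᴿ_ ; 0# = 0ℝ ; 1# = 1ℝ
  ; isCommutativeRing = record
    { isRing = record
      { +-isAbelianGroup = record
        { isGroup = record
          { isMonoid = record
            { isSemigroup = record
              { isMagma = record
                { isEquivalence = record { refl = ≈-refl ; sym = ≈-sym ; trans = ≈-trans }
                ; ∙-cong = +-cong }
              ; assoc = +-assoc }
            ; identity = +-identityˡ , +-identityʳ }
          ; inverse = +-inverseˡ , +-inverseʳ
          ; ⁻¹-cong = -‿cong }
        ; comm = +-comm }
      ; *-cong = *-cong
      ; *-assoc = *-assoc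
      ; *-identity = *-identityˡ , *-identityʳ
      ; distrib = *-distribˡ-+ , *-distribʳ-+ }
    ; *-comm = *-comm } }

open import Algebra.Properties.Semiring.Sum
  (CommutativeRing.semiring ℝ-commutativeRing) public using (sum)

record Graph : Set where
  field
    order       : ℕ
    adj         : Fin order → Fin order → Bool
    symmetric   : ∀ u v → adj u v ≡ adj v u
    irreflexive : ∀ v → adj v v ≡ false

  Vertex : Set
  Vertex = Fin order

  _~_ : Vertex → Vertex → Set
  u ~ v = adj u v ≡ true

  degree : Vertex → ℕ
  degree v = length (filter (λ u → adj v u 𝔹.≟ true) (allFin order))

open Graph public using (order; adj; Vertex; degree)

adjacencyMatrix : (G : Graph) → Vertex G → Vertex G → ℝ
adjacencyMatrix G u v = if adj G u v then 1ℝ else 0ℝ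

IsEigenvector : (G : Graph) → ℝ → Vector ℝ (order G) → Set
IsEigenvector G μ x = ∀ u → sum (λ v → adjacencyMatrix G u v *ᴿ x v) ≈ᴿ μ *ᴿ x u

combination : ∀ {m n} → Vector ℝ m → (Fin m → Vector ℝ n) → Vector ℝ n
combination c b u = sum (λ j → c j *ᴿ b j u)

-- "The eigenspace of μ has dimension m".  The adjacency matrix is real
-- symmetric, so its eigenvalues are real and this dimension is the
-- multiplicity of μ in the multiset of eigenvalues (0 if μ is not an
-- eigenvalue).
record HasMultiplicity (G : Graph) (μ : ℝ) (m : ℕ) : Set where
  field
    basis       : Fin m → Vector ℝ (order G)
    eigen       : ∀ j → IsEigenvector G μ (basis j)
    independent : ∀ c → (∀ u → combination c basis u ≈ᴿ 0ℝ) → ∀ j → c j ≈ᴿ 0ℝ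
    spanning    : ∀ x → IsEigenvector G μ x → ∃[ c ] (∀ u → x u ≈ᴿ combination c basis u)

SameSpectrum : Graph → Graph → Set
SameSpectrum G H = ∀ μ m → HasMultiplicity G μ m ⇔ HasMultiplicity H μ m

-- A bipartition is given by the side (true or false) of each vertex.
IsBipartition : (G : Graph) → (Vertex G → Bool) → Set
IsBipartition G side = ∀ u v → u ~ v → side u ≢ side v
  where open Graph G using (_~_)

Bipartite : Graph → Set
Bipartite G = ∃[ side ] IsBipartition G side

open import Relation.Binary.Properties.DecTotalOrder ℕ.≤-decTotalOrder
  using (≥-decTotalOrder)
open import Data.List.Sort ≥-decTotalOrder using (sort)

degreeSequence : (G : Graph) → (Vertex G → Bool) → Bool → List ℕ
degreeSequence G side s =
  sort (map (degree G) (filter (λ v → side v 𝔹.≟ s) (allFin (order G))))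

SameDegreeSequences : Graph → Graph → Set
SameDegreeSequences G H =
  Σ[ side ∈ (Vertex G → Bool) ] Σ[ side′ ∈ (Vertex H → Bool) ]
    IsBipartition G side × IsBipartition H side′ ×
    (∀ s → degreeSequence G side s ≡ degreeSequence H side′ s)

BiRegular : Graph → Set
BiRegular G = ∃[ side ] (IsBipartition G side ×
  (∀ u v → side u ≡ side v → degree G u ≡ degree G v))

-- A disconnected graph has several bipartitions; irregularity excludes
-- bi-regularity with respect to every one of them.
IrregularBipartite : Graph → Set
IrregularBipartite G = Bipartite G × ¬ BiRegular G

CyclicSuc : ∀ {k} → Fin k → Fin k → Set
CyclicSuc {k} i j = suc (toℕ i) ≡ toℕ j ⊎ (suc (toℕ i) ≡ k × toℕ j ≡ 0)

record Cycle (G : Graph) (k : ℕ) : Set where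
  open Graph G using (_~_)
  field
    3≤k       : 3 ≤ⁿ k
    vertex    : Fin k → Vertex G
    injective : Injective _≡_ _≡_ vertex
    adjacent  : ∀ i j → CyclicSuc i j → vertex i ~ vertex j

  HasEdge : Vertex G → Vertex G → Set
  HasEdge u v = ∃₂ λ i j → CyclicSuc i j ×
    ((vertex i ≡ u × vertex j ≡ v) ⊎ (vertex i ≡ v × vertex j ≡ u))

-- Cycles as subgraphs: starting point and direction are irrelevant.  The
-- vertex set need not be compared, as every vertex of a cycle is on an edge.
cycleSetoid : Graph → ℕ → Setoid 0ℓ 0ℓ
cycleSetoid G k = record
  { Carrier = Cycle G k
  ; _≈_     = λ c d → ∀ u v → Cycle.HasEdge c u v ⇔ Cycle.HasEdge d u v
  ; isEquivalence = record
    { refl  = λ u v → mk⇔ (λ e → e) (λ e → e)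
    ; sym   = λ p u v → mk⇔ (Equivalence.from (p u v)) (Equivalence.to (p u v))
    ; trans = λ p q u v → mk⇔ (Equivalence.to (q u v) ∘ Equivalence.to (p u v))
                              (Equivalence.from (p u v) ∘ Equivalence.from (q u v))
    }
  }

-- "G has exactly N cycles of length k".
CycleCount : Graph → ℕ → ℕ → Set
CycleCount G k N = Inverse (cycleSetoid G k) (setoid (Fin N))

HasGirth : Graph → ℕ → Set
HasGirth G g = Cycle G g × (∀ k → Cycle G k → g ≤ⁿ k)

{-# OPTIONS --safe #-}
module Submission where

-- The eigenvalues of the path P_n are 2 cos (πj / (n + 1)), and those of the cycle C_{2n} are 2, -2 and two
-- copies of those of P_{n-1}. So C_{2p} ∪ 2 P_{2p-1} and C_{4p} ∪ 2 P_{p-1} have the same spectrum, and they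
-- also have the same degree sequences. Start from D = D′ = C_6 ∪ P_5, and let p run from 4 to i + 5: whenever D
-- and D′ have equally many 2p-cycles, add the former to D and the latter to D′. This affects only the numbers of 2p-cycles and of
-- 4p-cycles, so that the numbers of 2p-cycles differ from then on.
--
-- Spectra are compared through linear isomorphisms of the eigenspaces, for all real μ at once. With the
-- Chebyshev polynomials s_k(μ) = U_{k-1}(μ/2), the eigenspace of P_n is the annihilator of s_{n+1}(μ) in ℝ, and
-- that of C_{2r} is the sum of the annihilators of s_r(μ) and of (4 - μ²) s_r(μ). Now s_{2r} = s_r v_r with
-- v_r² + (4 - μ²) s_r² = 4, and the annihilator of a product of coprime elements splits.

open import Defs
open import Algebra.Bundles using (CommutativeRing)
import Algebra.Solver.Ring as RingSolver
open import Algebra.Solver.Ring.AlmostCommutativeRing using (fromCommutativeRing; _-Raw-AlmostCommutative⟶_)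
open import Algebra.Properties.Semiring.Sum (CommutativeRing.semiring ℝ-commutativeRing) using (sum-cong-≋)
open import Data.Bool using (Bool; true; false; if_then_else_; not)
import Data.Bool.Properties as 𝔹
open import Data.Fin using (Fin; zero; suc; toℕ; fromℕ; fromℕ<; inject₁; splitAt; join; _↑ˡ_; _↑ʳ_)
open import Data.Fin.Induction using (<-weakInduction; <-weakInduction-startingFrom)
import Data.Fin.Properties as Fin
open import Data.List using (List; []; _∷_; _++_; _∷ʳ_; map; filter; foldr; tabulate; allFin; applyUpTo; length; replicate)
open import Data.List.Membership.Propositional using (_∈_)
open import Data.List.Membership.Propositional.Properties using (∈-++⁺ˡ; ∈-++⁺ʳ; ∈-++⁻; ∈-filter⁺; ∈-filter⁻; ∈-allFin)
open import Data.List.Membership.Propositional.Properties.WithK using (unique∧set⇒bag)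
import Data.List.Properties as List
open import Data.List.Relation.Binary.BagAndSetEquality using (∼bag⇒↭)
open import Data.List.Relation.Binary.Permutation.Propositional
  using (_↭_; ↭-refl; ↭-sym; ↭-trans; ↭-reflexive; ↭-prep; ↭⇒↭ₛ; ↭⇒↭ₛ′; module PermutationReasoning)
open import Data.List.Relation.Binary.Permutation.Propositional.Properties using (map⁺; ↭-length; shift; ∷↭∷ʳ; ++⁺)
import Data.List.Relation.Binary.Permutation.Setoid.Properties as Permutation
import Data.List.Relation.Binary.Pointwise as Pointwise
open import Data.List.Relation.Unary.AllPairs using ([]; _∷_)
open import Data.List.Relation.Unary.All using ([]; _∷_)
open import Data.List.Relation.Unary.Any using (here; there)
open import Data.List.Relation.Unary.Sorted.TotalOrder.Properties using (↗↭↗⇒≋)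
open import Data.List.Relation.Unary.Unique.Propositional using (Unique)
import Data.List.Relation.Unary.Unique.Propositional.Properties as Unique
open import Data.Maybe using (Maybe; just; nothing)
open import Data.Nat using (ℕ; zero; suc; z≤n; s≤s; _≟_; _<?_; _≤_; _<_; _+_; _*_)
open import Data.Nat.Divisibility using (_∣_; divides)
import Data.Nat.Properties as ℕ
open import Data.Nat.Tactic.RingSolver using (solve-∀)
open import Data.Product using (_,_; proj₁; proj₂; ∃; Σ-syntax; ∃₂; _×_)
open import Data.Rational using (½; 0ℚ; 1ℚ)
import Data.Rational as ℚ
import Data.Rational.Properties as ℚ
open import Data.Sum using (_⊎_; inj₁; inj₂; [_,_])
import Data.Sum as Sum
open import Data.Unit using (⊤; tt)
open import Data.Vec.Functional using (Vector)
open import Function using (_∘_; id; _⇔_; mk⇔; Equivalence; Inverse)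
import Function.Construct.Symmetry as Symmetry
open import Function.Properties.Bijection using (Bijection⇒Inverse)
open import Relation.Binary.Bundles using (Setoid; module DecTotalOrder)
open import Relation.Binary.Definitions using (Decidable)
open import Relation.Binary.Properties.DecTotalOrder ℕ.≤-decTotalOrder using (≥-decTotalOrder)
open import Data.List.Sort ≥-decTotalOrder using (sort; sort-↭; sort-↗)
open import Relation.Binary.PropositionalEquality as ≡ using (_≡_; _≢_; cong; cong₂; subst)
open import Relation.Nullary using (¬_; Dec; yes; no; does; contradiction)
open import Relation.Nullary.Decidable using (dec-true; dec-false; _⊎-dec_; _×-dec_)

-- Graphs and disjoint unions

-- Equality of Cauchy reals is not decidable constructively, so no step may ask whether μ is an
-- eigenvalue or divide by an expression in μ. Multiplicities are therefore never computed: a linear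
-- isomorphism of eigenspaces carries a basis over in either direction, whatever μ is. `Ann a`
-- stands for a factor of the characteristic polynomial, being all of ℝ when `a` vanishes and
-- trivial when `a` is invertible. Coprimality of factors and invertibility of transfer matrices are
-- witnessed by polynomial identities with no denominators but 2 and 4. The two equal paths are
-- coloured oppositely, so that each side receives the full degree list of one path, whatever the
-- parity of its order. In the starting graph, C_6 provides the girth and the only 6-cycle, and P_5
-- the irregularity: an end and the vertex two steps away share a side but have degrees 1 and 2. All
-- cycles added later have length at least 8. A 4p-cycle added to D′ can create or destroy a
-- difference at a later length. Hence each step has to be decided from the current counts and
-- cannot be fixed in advance.

Adjacent : (G : Graph) → Vertex G → Vertex G → Set
Adjacent G u v = adj G u v ≡ true

neighbours : (G : Graph) → Vertex G → List (Vertex G)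
neighbours G u = filter (λ v → adj G u v 𝔹.≟ true) (allFin (order G))

-- Two duplicate-free lists with the same elements are permutations of each other. Degrees and row
-- sums of the adjacency matrix do not depend on the order, so both can be read off any such list
-- `vs`.
neighbours-↭ : ∀ G u {vs} → Unique vs → (∀ v → v ∈ vs ⇔ Adjacent G u v) → neighbours G u ↭ vs
neighbours-↭ G u vs! vs⇔ = ∼bag⇒↭ (unique∧set⇒bag (Unique.filter⁺ _ (Unique.allFin⁺ _)) vs! (λ {v} → mk⇔
  (λ v∈ → Equivalence.from (vs⇔ v) (proj₂ (∈-filter⁻ (λ v → adj G u v 𝔹.≟ true) {xs = allFin _} v∈)))
  (λ v∈ → ∈-filter⁺ (λ v → adj G u v 𝔹.≟ true) (∈-allFin v) (Equivalence.to (vs⇔ v) v∈))))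

⊎-adj : ∀ G H → Vertex G ⊎ Vertex H → Vertex G ⊎ Vertex H → Bool
⊎-adj G H (inj₁ u) (inj₁ v) = adj G u v
⊎-adj G H (inj₁ _) (inj₂ _) = false
⊎-adj G H (inj₂ _) (inj₁ _) = false
⊎-adj G H (inj₂ u) (inj₂ v) = adj H u v

infixr 5 _∪_

_∪_ : Graph → Graph → Graph
G ∪ H = record
  { order       = order G + order H
  ; adj         = λ u v → ⊎-adj G H (splitAt (order G) u) (splitAt (order G) v)
  ; symmetric   = λ u v → symm (splitAt (order G) u) (splitAt (order G) v)
  ; irreflexive = λ v → irrefl (splitAt (order G) v)
  }
  where
  symm : ∀ u v → ⊎-adj G H u v ≡ ⊎-adj G H v u
  symm (inj₁ u) (inj₁ v) = Graph.symmetric G u v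
  symm (inj₁ _) (inj₂ _) = ≡.refl
  symm (inj₂ _) (inj₁ _) = ≡.refl
  symm (inj₂ u) (inj₂ v) = Graph.symmetric H u v
  irrefl : ∀ v → ⊎-adj G H v v ≡ false
  irrefl (inj₁ v) = Graph.irreflexive G v
  irrefl (inj₂ v) = Graph.irreflexive H v

module Union (G H : Graph) where

  m = order G
  n = order H

  injˡ : Vertex G → Vertex (G ∪ H)
  injˡ u = u ↑ˡ n

  injʳ : Vertex H → Vertex (G ∪ H)
  injʳ u = m ↑ʳ u

  adj-ˡˡ : ∀ u v → adj (G ∪ H) (injˡ u) (injˡ v) ≡ adj G u v
  adj-ˡˡ u v = cong₂ (⊎-adj G H) (Fin.splitAt-↑ˡ m u n) (Fin.splitAt-↑ˡ m v n)

  adj-ˡʳ : ∀ u v → adj (G ∪ H) (injˡ u) (injʳ v) ≡ false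
  adj-ˡʳ u v = cong₂ (⊎-adj G H) (Fin.splitAt-↑ˡ m u n) (Fin.splitAt-↑ʳ m n v)

  adj-ʳˡ : ∀ u v → adj (G ∪ H) (injʳ u) (injˡ v) ≡ false
  adj-ʳˡ u v = cong₂ (⊎-adj G H) (Fin.splitAt-↑ʳ m n u) (Fin.splitAt-↑ˡ m v n)

  adj-ʳʳ : ∀ u v → adj (G ∪ H) (injʳ u) (injʳ v) ≡ adj H u v
  adj-ʳʳ u v = cong₂ (⊎-adj G H) (Fin.splitAt-↑ʳ m n u) (Fin.splitAt-↑ʳ m n v)

  -- A view: matching on `side u` replaces `u` itself by `injˡ` or `injʳ` of a vertex, the form to
  -- which the adjacency equations above apply.
  data Side : Vertex (G ∪ H) → Set where
    left  : ∀ u → Side (injˡ u)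
    right : ∀ u → Side (injʳ u)

  side : ∀ u → Side u
  side u with splitAt m u in eq
  ... | inj₁ v = subst Side (Fin.splitAt⁻¹-↑ˡ eq) (left v)
  ... | inj₂ v = subst Side (Fin.splitAt⁻¹-↑ʳ eq) (right v)

  allFin-∪ : allFin (m + n) ≡ map injˡ (allFin m) ++ map injʳ (allFin n)
  allFin-∪ = ≡.trans (tabulate-+ m id) (≡.sym (cong₂ _++_ (List.map-tabulate id injˡ) (List.map-tabulate id injʳ)))
    where
    tabulate-+ : ∀ {A : Set} m {n} (f : Fin (m + n) → A) →
      tabulate f ≡ tabulate (f ∘ (_↑ˡ n)) ++ tabulate (f ∘ (m ↑ʳ_))
    tabulate-+ zero f = ≡.refl
    tabulate-+ (suc m) f = cong (f zero ∷_) (tabulate-+ m (f ∘ suc))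

  private
    filter-map : ∀ {A B : Set} (f : A → B) (p : B → Bool) (q : A → Bool) → (∀ a → p (f a) ≡ q a) →
      ∀ xs → filter (λ b → p b 𝔹.≟ true) (map f xs) ≡ map f (filter (λ a → q a 𝔹.≟ true) xs)
    filter-map f p q p≡q [] = ≡.refl
    filter-map f p q p≡q (x ∷ xs) rewrite p≡q x with q x
    ... | true  = cong (f x ∷_) (filter-map f p q p≡q xs)
    ... | false = filter-map f p q p≡q xs

    filter-false : ∀ {A B : Set} (f : A → B) (p : B → Bool) → (∀ a → p (f a) ≡ false) →
      ∀ xs → filter (λ b → p b 𝔹.≟ true) (map f xs) ≡ []
    filter-false f p p≡f [] = ≡.refl
    filter-false f p p≡f (x ∷ xs) rewrite p≡f x = filter-false f p p≡f xs

  neighbours-ˡ : ∀ u → neighbours (G ∪ H) (injˡ u) ≡ map injˡ (neighbours G u)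
  neighbours-ˡ u rewrite allFin-∪
    | List.filter-++ (λ v → adj (G ∪ H) (injˡ u) v 𝔹.≟ true) (map injˡ (allFin m)) (map injʳ (allFin n))
    | filter-map injˡ (adj (G ∪ H) (injˡ u)) (adj G u) (adj-ˡˡ u) (allFin m)
    | filter-false injʳ (adj (G ∪ H) (injˡ u)) (adj-ˡʳ u) (allFin n) = List.++-identityʳ _

  neighbours-ʳ : ∀ u → neighbours (G ∪ H) (injʳ u) ≡ map injʳ (neighbours H u)
  neighbours-ʳ u rewrite allFin-∪
    | List.filter-++ (λ v → adj (G ∪ H) (injʳ u) v 𝔹.≟ true) (map injˡ (allFin m)) (map injʳ (allFin n))
    | filter-map injʳ (adj (G ∪ H) (injʳ u)) (adj H u) (adj-ʳʳ u) (allFin n)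
    | filter-false injˡ (adj (G ∪ H) (injʳ u)) (adj-ʳˡ u) (allFin m) = ≡.refl

  degree-ˡ : ∀ u → degree (G ∪ H) (injˡ u) ≡ degree G u
  degree-ˡ u = ≡.trans (cong length (neighbours-ˡ u)) (List.length-map injˡ (neighbours G u))

  degree-ʳ : ∀ u → degree (G ∪ H) (injʳ u) ≡ degree H u
  degree-ʳ u = ≡.trans (cong length (neighbours-ʳ u)) (List.length-map injʳ (neighbours H u))

-- Bipartitions and degrees

sideDegrees : ∀ G → (Vertex G → Bool) → Bool → List ℕ
sideDegrees G σ b = map (degree G) (filter (λ v → σ v 𝔹.≟ b) (allFin (order G)))

module _ (G H : Graph) where
  open Union G H

  infixr 5 _∪ˢ_

  _∪ˢ_ : (Vertex G → Bool) → (Vertex H → Bool) → Vertex (G ∪ H) → Bool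
  (σ ∪ˢ τ) u = [ σ , τ ] (splitAt m u)

  bipartition-∪ : ∀ {σ τ} → IsBipartition G σ → IsBipartition H τ → IsBipartition (G ∪ H) (σ ∪ˢ τ)
  bipartition-∪ p q u v u~v with splitAt m u | splitAt m v
  ... | inj₁ i | inj₁ j = p i j u~v
  ... | inj₂ i | inj₂ j = q i j u~v

  sideDegrees-∪ : ∀ σ τ b → sideDegrees (G ∪ H) (σ ∪ˢ τ) b ≡ sideDegrees G σ b ++ sideDegrees H τ b
  sideDegrees-∪ σ τ b = split
    where
    part : ∀ {A : Set} (f : A → Vertex (G ∪ H)) (d : A → ℕ) (ρ : A → Bool) →
      (∀ a → degree (G ∪ H) (f a) ≡ d a) → (∀ a → (σ ∪ˢ τ) (f a) ≡ ρ a) → ∀ xs →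
      map (degree (G ∪ H)) (filter (λ v → (σ ∪ˢ τ) v 𝔹.≟ b) (map f xs)) ≡ map d (filter (λ a → ρ a 𝔹.≟ b) xs)
    part f d ρ d≡ ρ≡ [] = ≡.refl
    part f d ρ d≡ ρ≡ (x ∷ xs) rewrite ρ≡ x with does (ρ x 𝔹.≟ b)
    ... | true  = cong₂ _∷_ (d≡ x) (part f d ρ d≡ ρ≡ xs)
    ... | false = part f d ρ d≡ ρ≡ xs
    P? = λ v → (σ ∪ˢ τ) v 𝔹.≟ b
    split : sideDegrees (G ∪ H) (σ ∪ˢ τ) b ≡ sideDegrees G σ b ++ sideDegrees H τ b
    split = ≡.trans (cong (map (degree (G ∪ H)) ∘ filter P?) allFin-∪) (≡.trans
      (cong (map (degree (G ∪ H))) (List.filter-++ P? (map injˡ (allFin m)) (map injʳ (allFin n)))) (≡.trans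
      (List.map-++ (degree (G ∪ H)) (filter P? (map injˡ (allFin m))) (filter P? (map injʳ (allFin n))))
      (cong₂ _++_
        (part injˡ (degree G) σ degree-ˡ (λ u → cong [ σ , τ ] (Fin.splitAt-↑ˡ m u n)) (allFin m))
        (part injʳ (degree H) τ degree-ʳ (λ u → cong [ σ , τ ] (Fin.splitAt-↑ʳ m n u)) (allFin n)))))

sort-cong : ∀ {xs ys} → xs ↭ ys → sort xs ≡ sort ys
sort-cong {xs} {ys} xs↭ys = Pointwise.Pointwise-≡⇒≡ (↗↭↗⇒≋ (DecTotalOrder.totalOrder ≥-decTotalOrder)
  (sort-↗ xs) (sort-↗ ys) (↭⇒↭ₛ (↭-trans (sort-↭ xs) (↭-trans xs↭ys (↭-sym (sort-↭ ys))))))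

-- Two vertices with a common neighbour lie on the same side of every bipartition.
Irregular : Graph → Set
Irregular G = ∃ λ u → ∃ λ v → ∃ λ w → Adjacent G u v × Adjacent G v w × degree G u ≢ degree G w

irregular⇒¬biRegular : ∀ {G} → Irregular G → ¬ BiRegular G
irregular⇒¬biRegular (u , v , w , u~v , v~w , u≢w) (σ , bip , reg) = u≢w (reg u w
  (≡.trans (𝔹.¬-not (bip u v u~v)) (≡.sym (𝔹.¬-not (bip v w v~w ∘ ≡.sym)))))

module _ (G H : Graph) where
  open Union G H

  irregular-ˡ : Irregular G → Irregular (G ∪ H)
  irregular-ˡ (u , v , w , u~v , v~w , u≢w) = injˡ u , injˡ v , injˡ w ,
    ≡.trans (adj-ˡˡ u v) u~v , ≡.trans (adj-ˡˡ v w) v~w ,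
    λ e → u≢w (≡.trans (≡.sym (degree-ˡ u)) (≡.trans e (degree-ˡ w)))

  irregular-ʳ : Irregular H → Irregular (G ∪ H)
  irregular-ʳ (u , v , w , u~v , v~w , u≢w) = injʳ u , injʳ v , injʳ w ,
    ≡.trans (adj-ʳʳ u v) u~v , ≡.trans (adj-ʳʳ v w) v~w ,
    λ e → u≢w (≡.trans (≡.sym (degree-ʳ u)) (≡.trans e (degree-ʳ w)))

-- Paths and cycles

module SymmetricClosure (n : ℕ) (_⟶_ : Fin n → Fin n → Set) (_⟶?_ : Decidable _⟶_)
  (irrefl : ∀ v → ¬ (v ⟶ v)) where

  graph : Graph
  graph = record
    { order       = n
    ; adj         = λ u v → does ((u ⟶? v) ⊎-dec (v ⟶? u))
    ; symmetric   = λ u v → 𝔹.∨-comm (does (u ⟶? v)) (does (v ⟶? u))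
    ; irreflexive = λ v → dec-false ((v ⟶? v) ⊎-dec (v ⟶? v)) [ irrefl v , irrefl v ]
    }

  adjacent⁺ : ∀ u v → (u ⟶ v) ⊎ (v ⟶ u) → Adjacent graph u v
  adjacent⁺ u v = dec-true ((u ⟶? v) ⊎-dec (v ⟶? u))

  adjacent⁻ : ∀ u v → Adjacent graph u v → (u ⟶ v) ⊎ (v ⟶ u)
  adjacent⁻ u v = does-true ((u ⟶? v) ⊎-dec (v ⟶? u))
    where
    does-true : ∀ {A : Set} (a? : Dec A) → does a? ≡ true → A
    does-true (yes a) _ = a

_⟶ᴾ_ : ∀ {n} → Fin n → Fin n → Set
i ⟶ᴾ j = suc (toℕ i) ≡ toℕ j

module PathGraph (n : ℕ) = SymmetricClosure n _⟶ᴾ_ (λ i j → suc (toℕ i) ≟ toℕ j) (λ v → ℕ.1+n≢n)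

path : ℕ → Graph
path = PathGraph.graph

-- The vertex of a path with one-based index k, if there is one.
spot : ∀ n → ℕ → List (Fin n)
spot n zero = []
spot n (suc k) with k <? n
... | yes k<n = fromℕ< k<n ∷ []
... | no  _   = []

∈-spot⁻ : ∀ {n} k {v : Fin n} → v ∈ spot n k → suc (toℕ v) ≡ k
∈-spot⁻ {n} (suc k) v∈ with k <? n
∈-spot⁻ {n} (suc k) (here ≡.refl) | yes k<n = cong suc (Fin.toℕ-fromℕ< k<n)

spot-toℕ : ∀ {n} (v : Fin n) → spot n (suc (toℕ v)) ≡ v ∷ []
spot-toℕ {n} v with toℕ v <? n
... | yes v<n = cong (_∷ []) (Fin.fromℕ<-toℕ v v<n)
... | no  v≮n = contradiction (Fin.toℕ<n v) v≮n

spot-> : ∀ n → spot n (suc n) ≡ []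
spot-> n with n <? n
... | yes n<n = contradiction n<n (ℕ.n≮n n)
... | no  _   = ≡.refl

∈-spot⁺ : ∀ {n k} {v : Fin n} → suc (toℕ v) ≡ k → v ∈ spot n k
∈-spot⁺ {v = v} ≡.refl = subst (v ∈_) (≡.sym (spot-toℕ v)) (here ≡.refl)

spot-unique : ∀ n k → Unique (spot n k)
spot-unique n zero = []
spot-unique n (suc k) with k <? n
... | yes _ = [] ∷ []
... | no  _ = []

-- In one-based indices `u` is `suc (toℕ u)`, so its neighbours are at `toℕ u` and `2 + toℕ u`.
-- Beyond either end `spot` is empty, so the ends need no separate treatment.
path-neighbours : ∀ n u → neighbours (path n) u ↭ spot n (toℕ u) ++ spot n (2 + toℕ u)
path-neighbours n u = neighbours-↭ (path n) u
  (Unique.++⁺ (spot-unique n (toℕ u)) (spot-unique n (2 + toℕ u)) λ (v∈ , v∈′) →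
    ℕ.m≢1+n+m (toℕ u) (≡.trans (≡.sym (∈-spot⁻ (toℕ u) v∈)) (∈-spot⁻ (2 + toℕ u) v∈′)))
  (λ v → mk⇔
    (λ v∈ → PathGraph.adjacent⁺ n u v (Sum.swap (Sum.map (∈-spot⁻ (toℕ u)) (≡.sym ∘ ℕ.suc-injective ∘ ∈-spot⁻ (2 + toℕ u))
      (∈-++⁻ (spot n (toℕ u)) v∈))))
    (λ u~v → [ (λ p → ∈-++⁺ʳ (spot n (toℕ u)) (∈-spot⁺ (cong suc (≡.sym p)))) , (λ p → ∈-++⁺ˡ (∈-spot⁺ p)) ]
      (PathGraph.adjacent⁻ n u v u~v)))

cyclicSuc? : ∀ {n} → Decidable (CyclicSuc {n})
cyclicSuc? {n} i j = (suc (toℕ i) ≟ toℕ j) ⊎-dec ((suc (toℕ i) ≟ n) ×-dec (toℕ j ≟ 0))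

next : ∀ {n} (i : Fin n) → ∃ λ j → CyclicSuc i j
next {suc n} i with suc (toℕ i) <? suc n
... | yes i<n = fromℕ< i<n , inj₁ (≡.sym (Fin.toℕ-fromℕ< i<n))
... | no  i≮n = zero , inj₂ (ℕ.≤-antisym (Fin.toℕ<n i) (ℕ.≮⇒≥ i≮n) , ≡.refl)

prev : ∀ {n} (j : Fin n) → ∃ λ i → CyclicSuc i j
prev {suc n} zero    = fromℕ n , inj₂ (cong suc (Fin.toℕ-fromℕ n) , ≡.refl)
prev {suc n} (suc j) = inject₁ j , inj₁ (cong suc (Fin.toℕ-inject₁ j))

cyclicSuc-functional : ∀ {n} {i j k : Fin n} → CyclicSuc i j → CyclicSuc i k → j ≡ k
cyclicSuc-functional (inj₁ p) (inj₁ q) = Fin.toℕ-injective (≡.trans (≡.sym p) q)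
cyclicSuc-functional {j = j} (inj₁ p) (inj₂ (q , _)) = contradiction (≡.trans (≡.sym p) q) (ℕ.<⇒≢ (Fin.toℕ<n j))
cyclicSuc-functional {k = k} (inj₂ (p , _)) (inj₁ q) = contradiction (≡.trans (≡.sym q) p) (ℕ.<⇒≢ (Fin.toℕ<n k))
cyclicSuc-functional (inj₂ (_ , p)) (inj₂ (_ , q)) = Fin.toℕ-injective (≡.trans p (≡.sym q))

cyclicSuc-injective : ∀ {n} {i j k : Fin n} → CyclicSuc i k → CyclicSuc j k → i ≡ j
cyclicSuc-injective (inj₁ p) (inj₁ q) = Fin.toℕ-injective (ℕ.suc-injective (≡.trans p (≡.sym q)))
cyclicSuc-injective (inj₁ p) (inj₂ (_ , q)) = contradiction (≡.trans p q) ℕ.1+n≢0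
cyclicSuc-injective (inj₂ (_ , p)) (inj₁ q) = contradiction (≡.trans q p) ℕ.1+n≢0
cyclicSuc-injective (inj₂ (p , _)) (inj₂ (q , _)) = Fin.toℕ-injective (ℕ.suc-injective (≡.trans p (≡.sym q)))

-- Two steps around a cycle of length `n` lead back to the start only if `n` divides 2. This keeps
-- the cycle graph loopless and the two neighbours of each vertex distinct.
cyclicSuc-asym : ∀ {n} → 3 ≤ n → {i j k : Fin n} → CyclicSuc i j → CyclicSuc j k → i ≢ k
cyclicSuc-asym _ {i} (inj₁ p) (inj₁ q) ≡.refl =
  ℕ.m≢1+n+m (toℕ i) {1} (≡.sym (≡.trans (cong suc p) q))
cyclicSuc-asym 3≤n {i} (inj₁ p) (inj₂ (q , r)) ≡.refl =
  ℕ.<⇒≢ 3≤n (≡.trans (cong (λ k → suc (suc k)) (≡.sym r)) (≡.trans (cong suc p) q))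
cyclicSuc-asym 3≤n {j = j} (inj₂ (p , q)) (inj₁ r) ≡.refl =
  ℕ.<⇒≢ 3≤n (≡.trans (cong (λ k → suc (suc k)) (≡.sym q)) (≡.trans (cong suc r) p))
cyclicSuc-asym 3≤n {j = j} (inj₂ (p , q)) (inj₂ (r , _)) ≡.refl =
  ℕ.<⇒≢ (ℕ.<-trans (s≤s (s≤s z≤n)) 3≤n) (≡.trans (cong suc (≡.sym q)) r)

cyclicSuc-irrefl : ∀ {n} → 3 ≤ n → (i : Fin n) → ¬ CyclicSuc i i
cyclicSuc-irrefl 3≤n i p = cyclicSuc-asym 3≤n p p ≡.refl

module CycleGraph (n : ℕ) (3≤n : 3 ≤ n) = SymmetricClosure n CyclicSuc cyclicSuc? (cyclicSuc-irrefl 3≤n)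

cycle : ∀ n → 3 ≤ n → Graph
cycle = CycleGraph.graph

module _ {n : ℕ} (3≤n : 3 ≤ n) {i j k : Fin n} (i⟶j : CyclicSuc i j) (j⟶k : CyclicSuc j k) where

  cycle-neighbours : neighbours (cycle n 3≤n) j ↭ k ∷ i ∷ []
  cycle-neighbours = neighbours-↭ (cycle n 3≤n) j
    (((λ k≡i → cyclicSuc-asym 3≤n i⟶j j⟶k (≡.sym k≡i)) ∷ []) ∷ [] ∷ [])
    (λ v → mk⇔
      (λ { (here ≡.refl) → CycleGraph.adjacent⁺ n 3≤n j v (inj₁ j⟶k)
         ; (there (here ≡.refl)) → CycleGraph.adjacent⁺ n 3≤n j v (inj₂ i⟶j) })
      (λ j~v → [ (λ j⟶v → here (cyclicSuc-functional j⟶v j⟶k))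
               , (λ v⟶j → there (here (cyclicSuc-injective v⟶j i⟶j))) ] (CycleGraph.adjacent⁻ n 3≤n j v j~v)))

cycle∪paths : ∀ n → 3 ≤ n → ℕ → Graph
cycle∪paths n 3≤n m = cycle n 3≤n ∪ (path m ∪ path m)

-- Parity colourings and the degrees on each side

even : ℕ → Bool
even zero    = true
even (suc n) = not (even n)

parity : ∀ {n} → Fin n → Bool
parity = even ∘ toℕ

even-double : ∀ p → even (p + p) ≡ true
even-double zero = ≡.refl
even-double (suc p) = ≡.trans (cong (not ∘ even) (ℕ.+-suc p p)) (≡.trans (𝔹.not-involutive _) (even-double p))

parity-suc : ∀ {n} {i j : Fin n} → i ⟶ᴾ j → parity j ≡ not (parity i)
parity-suc p = cong even (≡.sym p)

parity-path : ∀ n → IsBipartition (path n) parity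
parity-path n u v u~v with PathGraph.adjacent⁻ n u v u~v
... | inj₁ p = λ e → 𝔹.not-¬ (≡.sym e) (parity-suc p)
... | inj₂ p = λ e → 𝔹.not-¬ e (parity-suc p)

module _ (p : ℕ) (3≤n : 3 ≤ p + p) where

  parity-cyclicSuc : ∀ {i j : Fin (p + p)} → CyclicSuc i j → parity j ≡ not (parity i)
  parity-cyclicSuc (inj₁ q) = parity-suc q
  -- The wrap-around leads to index 0, which has the parity of `suc (toℕ i)` because that number is
  -- the even `p + p`.
  parity-cyclicSuc (inj₂ (q , r)) = ≡.trans (cong even r) (≡.trans (≡.sym (even-double p)) (cong even (≡.sym q)))

  parity-cycle : IsBipartition (cycle (p + p) 3≤n) parity
  parity-cycle u v u~v with CycleGraph.adjacent⁻ (p + p) 3≤n u v u~v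
  ... | inj₁ q = λ e → 𝔹.not-¬ (≡.sym e) (parity-cyclicSuc q)
  ... | inj₂ q = λ e → 𝔹.not-¬ e (parity-cyclicSuc q)

bipartition-not : ∀ G {σ} → IsBipartition G σ → IsBipartition G (not ∘ σ)
bipartition-not G p u v u~v e = p u v u~v (𝔹.not-injective e)

length-filter-opposite : ∀ {A : Set} (q : A → Bool) b x y xs → q y ≡ not (q x) →
  length (filter (λ a → q a 𝔹.≟ b) (x ∷ y ∷ xs)) ≡ suc (length (filter (λ a → q a 𝔹.≟ b) xs))
length-filter-opposite q b x y xs eq with q x | eq | b
... | true  | eq | true  rewrite eq = ≡.refl
... | true  | eq | false rewrite eq = ≡.refl
... | false | eq | true  rewrite eq = ≡.refl
... | false | eq | false rewrite eq = ≡.refl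

-- Of each two consecutive entries exactly one has colour `b`, so the list is consumed in pairs. A
-- general `f` lets the induction pass to the tail.
length-filter-alternating : ∀ {A : Set} (q : A → Bool) b p {n} → n ≡ p * 2 → (f : Fin n → A) →
  (∀ i j → i ⟶ᴾ j → q (f j) ≡ not (q (f i))) → length (filter (λ a → q a 𝔹.≟ b) (tabulate f)) ≡ p
length-filter-alternating q b zero ≡.refl f alt = ≡.refl
length-filter-alternating q b (suc p) ≡.refl f alt = ≡.trans
  (length-filter-opposite q b (f zero) (f (suc zero)) _ (alt zero (suc zero) ≡.refl))
  (cong suc (length-filter-alternating q b p ≡.refl (λ i → f (suc (suc i)))
    (λ i j e → alt (suc (suc i)) (suc (suc j)) (cong (2 +_) e))))

map-const : ∀ {A : Set} {f : A → ℕ} {c} → (∀ a → f a ≡ c) → ∀ xs → map f xs ≡ replicate (length xs) c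
map-const f≡c [] = ≡.refl
map-const f≡c (x ∷ xs) = cong₂ _∷_ (f≡c x) (map-const f≡c xs)

sideDegrees-cycle : ∀ p 3≤n b → sideDegrees (cycle (p + p) 3≤n) parity b ≡ replicate p 2
sideDegrees-cycle p 3≤n b = ≡.trans
  (map-const (λ v → ↭-length (cycle-neighbours 3≤n (proj₂ (prev v)) (proj₂ (next v)))) _)
  (cong (λ k → replicate k 2) (length-filter-alternating parity b p
    (≡.trans (cong (p +_) (≡.sym (ℕ.+-identityʳ p))) (ℕ.*-comm 2 p)) id (λ i j → parity-suc)))

filter-not : ∀ {A : Set} (q : A → Bool) b xs →
  filter (λ a → q a 𝔹.≟ b) xs ++ filter (λ a → not (q a) 𝔹.≟ b) xs ↭ xs
filter-not q b [] = ↭-refl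
filter-not q b (x ∷ xs) with ih ← filter-not q b xs with q x | b
... | true  | true  = ↭-prep x ih
... | true  | false = ↭-trans (shift x (filter (λ a → q a 𝔹.≟ false) xs) _) (↭-prep x ih)
... | false | true  = ↭-trans (shift x (filter (λ a → q a 𝔹.≟ true) xs) _) (↭-prep x ih)
... | false | false = ↭-prep x ih

-- Each vertex has colour `b` in exactly one of the two oppositely coloured copies. Each side thus
-- sees one whole copy of `G`, and where the ends of a path fall is irrelevant.
sideDegrees-not : ∀ G σ b → sideDegrees (G ∪ G) (_∪ˢ_ G G σ (not ∘ σ)) b ↭ map (degree G) (allFin (order G))
sideDegrees-not G σ b = ↭-trans
  (↭-reflexive (≡.trans (sideDegrees-∪ G G σ (not ∘ σ) b)
    (≡.sym (List.map-++ (degree G) (filter (λ a → σ a 𝔹.≟ b) (allFin _)) _))))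
  (map⁺ (degree G) (filter-not σ b (allFin _)))

length-spot : ∀ {n k} → k < n → length (spot n (suc k)) ≡ 1
length-spot {n} {k} k<n with k <? n
... | yes _  = ≡.refl
... | no k≮n = contradiction k<n k≮n

tabulate-toℕ : ∀ {A : Set} (f : ℕ → A) n → tabulate {n = n} (f ∘ toℕ) ≡ applyUpTo f n
tabulate-toℕ f zero = ≡.refl
tabulate-toℕ f (suc n) = cong (f 0 ∷_) (tabulate-toℕ (f ∘ suc) n)

applyUpTo-const : ∀ {A : Set} (f : ℕ → A) {c} n → (∀ k → k < n → f k ≡ c) → applyUpTo f n ≡ replicate n c
applyUpTo-const f zero f≡c = ≡.refl
applyUpTo-const f (suc n) f≡c = cong₂ _∷_ (f≡c 0 (s≤s z≤n)) (applyUpTo-const (f ∘ suc) n (λ k k<n → f≡c (suc k) (s≤s k<n)))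

degrees-path : ∀ m → map (degree (path (2 + m))) (allFin (2 + m)) ≡ 1 ∷ replicate m 2 ∷ʳ 1
degrees-path m = begin
  map (degree (path n)) (allFin n)  ≡⟨ List.map-tabulate id (degree (path n)) ⟩
  tabulate (degree (path n))        ≡⟨ List.tabulate-cong (λ v → ↭-length (path-neighbours n v)) ⟩
  tabulate (d ∘ toℕ)                ≡⟨ tabulate-toℕ d n ⟩
  d 0 ∷ applyUpTo (d ∘ suc) (suc m)
    ≡⟨ cong₂ _∷_ (length-spot {n} {1} (s≤s (s≤s z≤n))) (≡.sym (List.applyUpTo-∷ʳ (d ∘ suc) m)) ⟩
  1 ∷ applyUpTo (d ∘ suc) m ∷ʳ d (suc m)
    ≡⟨ cong (1 ∷_) (cong₂ _∷ʳ_ (applyUpTo-const (d ∘ suc) m inner) last) ⟩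
  1 ∷ replicate m 2 ∷ʳ 1 ∎
  where
  open ≡.≡-Reasoning
  n = 2 + m
  d : ℕ → ℕ
  d k = length (spot n k ++ spot n (2 + k))
  inner : ∀ k → k < m → d (suc k) ≡ 2
  inner k k<m = ≡.trans (List.length-++ (spot n (suc k)))
    (cong₂ _+_ (length-spot (ℕ.<-trans k<m (ℕ.m<n+m m (s≤s z≤n)))) (length-spot (s≤s (s≤s k<m))))
  last : d (suc m) ≡ 1
  last = ≡.trans (List.length-++ (spot n (suc m)))
    (cong₂ _+_ (length-spot {n} {m} (ℕ.m<n+m m (s≤s z≤n))) (cong length (spot-> n)))

paths-side : ∀ m → Vertex (path m ∪ path m) → Bool
paths-side m = _∪ˢ_ (path m) (path m) parity (not ∘ parity)

cycle∪paths-side : ∀ n 3≤n m → Vertex (cycle∪paths n 3≤n m) → Bool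
cycle∪paths-side n 3≤n m = _∪ˢ_ (cycle n 3≤n) (path m ∪ path m) parity (paths-side m)

cycle∪paths-bipartition : ∀ p 3≤n m → IsBipartition (cycle∪paths (p + p) 3≤n m) (cycle∪paths-side (p + p) 3≤n m)
cycle∪paths-bipartition p 3≤n m = bipartition-∪ (cycle (p + p) 3≤n) (path m ∪ path m) (parity-cycle p 3≤n)
  (bipartition-∪ (path m) (path m) (parity-path m) (bipartition-not (path m) (parity-path m)))

-- Each side gets `p` vertices of the cycle and one whole path with `m` inner vertices, so only
-- `p + m` matters. For the two graphs exchanged at p this is p + (2p - 3) and 2p + (p - 3), the
-- same number.
sideDegrees-cycle∪paths : ∀ p 3≤n {n m k} → n ≡ 2 + m → p + m ≡ k → ∀ b →
  sideDegrees (cycle∪paths (p + p) 3≤n n) (cycle∪paths-side (p + p) 3≤n n) b ↭ 1 ∷ 1 ∷ replicate k 2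
sideDegrees-cycle∪paths p 3≤n {m = m} ≡.refl ≡.refl b = begin
  sideDegrees (cycle∪paths (p + p) 3≤n (2 + m)) (cycle∪paths-side (p + p) 3≤n (2 + m)) b
    ≡⟨ sideDegrees-∪ (cycle (p + p) 3≤n) (path (2 + m) ∪ path (2 + m)) parity (paths-side (2 + m)) b ⟩
  sideDegrees (cycle (p + p) 3≤n) parity b ++ sideDegrees (path (2 + m) ∪ path (2 + m)) (paths-side (2 + m)) b
    ↭⟨ ++⁺ (↭-reflexive (sideDegrees-cycle p 3≤n b)) (sideDegrees-not (path (2 + m)) parity b) ⟩
  replicate p 2 ++ map (degree (path (2 + m))) (allFin (2 + m))
    ≡⟨ cong (replicate p 2 ++_) (degrees-path m) ⟩
  replicate p 2 ++ 1 ∷ replicate m 2 ∷ʳ 1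
    ↭⟨ shift 1 (replicate p 2) _ ⟩
  1 ∷ replicate p 2 ++ replicate m 2 ∷ʳ 1
    ≡⟨ cong (1 ∷_) (List.++-assoc (replicate p 2) (replicate m 2) _) ⟨
  1 ∷ (replicate p 2 ++ replicate m 2) ∷ʳ 1
    ↭⟨ ↭-prep 1 (∷↭∷ʳ 1 (replicate p 2 ++ replicate m 2)) ⟨
  1 ∷ 1 ∷ replicate p 2 ++ replicate m 2
    ≡⟨ cong (λ xs → 1 ∷ 1 ∷ xs) (replicate-++ p) ⟩
  1 ∷ 1 ∷ replicate (p + m) 2 ∎
  where
  open PermutationReasoning
  replicate-++ : ∀ p → replicate p 2 ++ replicate m 2 ≡ replicate (p + m) 2
  replicate-++ zero = ≡.refl
  replicate-++ (suc p) = cong (2 ∷_) (replicate-++ p)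

-- Counting cycles

open Cycle

infix 4 _≋_

_≋_ : ∀ {G k} → Cycle G k → Cycle G k → Set
_≋_ {G} {k} = Setoid._≈_ (cycleSetoid G k)

module _ {G : Graph} {k : ℕ} where
  open Setoid (cycleSetoid G k) public using () renaming (refl to ≋-refl; sym to ≋-sym; trans to ≋-trans)

Adjacent-sym : ∀ G {u v} → Adjacent G u v → Adjacent G v u
Adjacent-sym G {u} {v} u~v = ≡.trans (Graph.symmetric G v u) u~v

module _ {G : Graph} {k : ℕ} (c : Cycle G k) where

  edge : ∀ {i j} → CyclicSuc i j → HasEdge c (vertex c i) (vertex c j)
  edge i⟶j = _ , _ , i⟶j , inj₁ (≡.refl , ≡.refl)

  HasEdge-sym : ∀ {u v} → HasEdge c u v → HasEdge c v u
  HasEdge-sym (i , j , i⟶j , e) = i , j , i⟶j , Sum.swap e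

  HasEdge⇒Adjacent : ∀ {u v} → HasEdge c u v → Adjacent G u v
  HasEdge⇒Adjacent (i , j , i⟶j , inj₁ (≡.refl , ≡.refl)) = adjacent c i j i⟶j
  HasEdge⇒Adjacent (i , j , i⟶j , inj₂ (≡.refl , ≡.refl)) = Adjacent-sym G (adjacent c i j i⟶j)

  first : Fin k
  first = fromℕ< (ℕ.≤-trans (s≤s z≤n) (3≤k c))

  two-edges : ∀ i → ∃₂ λ j l → HasEdge c (vertex c i) (vertex c j) × HasEdge c (vertex c i) (vertex c l) ×
    vertex c j ≢ vertex c l
  two-edges i with (j , i⟶j) ← next i | (l , l⟶i) ← prev i =
    j , l , edge i⟶j , HasEdge-sym (edge l⟶i) ,
    λ eq → cyclicSuc-asym (3≤k c) l⟶i i⟶j (≡.sym (injective c eq))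

-- Climb from `i` to the last index, wrap around to 0, and climb again from there.
CyclicSuc-induction : ∀ {k} (P : Fin k → Set) → (∀ {i j} → CyclicSuc i j → P i → P j) → ∀ {i} → P i → ∀ j → P j
CyclicSuc-induction {suc k} P step {i} Pi = <-weakInduction P
  (step (inj₂ (cong suc (Fin.toℕ-fromℕ k) , ≡.refl))
    (<-weakInduction-startingFrom P Pi (λ j → step (up j)) (Fin.≤fromℕ i)))
  (λ j → step (up j))
  where
  up : ∀ (j : Fin k) → CyclicSuc (inject₁ j) (suc j)
  up j = inj₁ (cong suc (Fin.toℕ-inject₁ j))

count : ∀ {G k N} (f : Fin N → Cycle G k) → (∀ i j → f i ≋ f j → i ≡ j) → (∀ c → ∃ λ i → f i ≋ c) → CycleCount G k N
count {G} {k} f inj surj = Symmetry.inverse (Bijection⇒Inverse (record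
  { to = f
  ; cong = λ {i} → λ { ≡.refl → ≋-refl {G} {k} {f i} }
  ; bijective = (λ {i} {j} → inj i j) , λ c → let (i , e) = surj c in i , λ { ≡.refl → e }
  }))

count-0 : ∀ {G k} → ¬ Cycle G k → CycleCount G k 0
count-0 ∄ = count (λ ()) (λ ()) (λ c → contradiction c ∄)

count-1 : ∀ {G k} (c : Cycle G k) → (∀ d → c ≋ d) → CycleCount G k 1
count-1 c unique = count (λ _ → c) (λ { zero zero _ → ≡.refl ; zero (suc ()) _ ; (suc ()) _ _ }) (λ d → zero , unique d)

-- Cycles under induced embeddings and in disjoint unions

record _↪_ (G K : Graph) : Set where
  field
    φ      : Vertex G → Vertex K
    φ-inj  : ∀ {u v} → φ u ≡ φ v → u ≡ v
    adj-φ  : ∀ u v → adj K (φ u) (φ v) ≡ adj G u v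

  image : ∀ {k} → Cycle G k → Cycle K k
  image c = record
    { 3≤k = 3≤k c
    ; vertex = φ ∘ vertex c
    ; injective = injective c ∘ φ-inj
    ; adjacent = λ i j i⟶j → ≡.trans (adj-φ _ _) (adjacent c i j i⟶j)
    }

  module _ {k : ℕ} where

    private
      image⁺ : ∀ (c : Cycle G k) {u v} → HasEdge c u v → HasEdge (image c) (φ u) (φ v)
      image⁺ c (i , j , i⟶j , e) = i , j , i⟶j ,
        Sum.map (λ (p , q) → cong φ p , cong φ q) (λ (p , q) → cong φ p , cong φ q) e

      image⁻ : ∀ (c : Cycle G k) {u v} → HasEdge (image c) (φ u) (φ v) → HasEdge c u v
      image⁻ c (i , j , i⟶j , e) = i , j , i⟶j ,
        Sum.map (λ (p , q) → φ-inj p , φ-inj q) (λ (p , q) → φ-inj p , φ-inj q) e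

      cong-→ : ∀ (c d : Cycle G k) → c ≋ d → ∀ {x y} → HasEdge (image c) x y → HasEdge (image d) x y
      cong-→ c d c≋d (i , j , i⟶j , inj₁ (≡.refl , ≡.refl)) = image⁺ d (Equivalence.to (c≋d _ _) (edge c i⟶j))
      cong-→ c d c≋d (i , j , i⟶j , inj₂ (≡.refl , ≡.refl)) =
        image⁺ d (Equivalence.to (c≋d _ _) (HasEdge-sym c (edge c i⟶j)))

    image-cong : ∀ (c d : Cycle G k) → c ≋ d → image c ≋ image d
    image-cong c d c≋d x y = mk⇔ (cong-→ c d c≋d) (cong-→ d c (≋-sym {x = c} {y = d} c≋d))

    image-injective : ∀ (c d : Cycle G k) → image c ≋ image d → c ≋ d
    image-injective c d e u v = mk⇔
      (λ p → image⁻ d (Equivalence.to (e _ _) (image⁺ c p)))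
      (λ p → image⁻ c (Equivalence.from (e _ _) (image⁺ d p)))

  -- Since `adj-φ` is an equality, adjacency is reflected as well as preserved. Hence a cycle whose
  -- vertices all lie in the image can be pulled back along `φ`.
  preimage : ∀ {k} (c : Cycle K k) → (∀ i → ∃ λ u → φ u ≡ vertex c i) → ∃ λ d → image d ≋ c
  preimage c lift = d , λ x y → mk⇔
    (λ (i , j , i⟶j , e) → i , j , i⟶j , subst (λ (a , b) → (a ≡ x × b ≡ y) ⊎ (a ≡ y × b ≡ x)) (eq i j) e)
    (λ (i , j , i⟶j , e) → i , j , i⟶j , subst (λ (a , b) → (a ≡ x × b ≡ y) ⊎ (a ≡ y × b ≡ x)) (≡.sym (eq i j)) e)
    where
    d : Cycle _ _
    d = record
      { 3≤k = 3≤k c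
      ; vertex = proj₁ ∘ lift
      ; injective = λ {i} {j} e → injective c
          (≡.trans (≡.sym (proj₂ (lift i))) (≡.trans (cong φ e) (proj₂ (lift j))))
      ; adjacent = λ i j i⟶j → ≡.trans (≡.sym (adj-φ _ _))
          (≡.trans (cong₂ (adj K) (proj₂ (lift i)) (proj₂ (lift j))) (adjacent c i j i⟶j))
      }
    eq : ∀ i j → (φ (vertex d i) , φ (vertex d j)) ≡ (vertex c i , vertex c j)
    eq i j = cong₂ _,_ (proj₂ (lift i)) (proj₂ (lift j))

module _ (G H : Graph) where
  open Union G H
  open _↪_

  ↪ˡ : G ↪ (G ∪ H)
  ↪ˡ = record { φ = injˡ ; φ-inj = Fin.↑ˡ-injective n _ _ ; adj-φ = adj-ˡˡ }

  ↪ʳ : H ↪ (G ∪ H)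
  ↪ʳ = record { φ = injʳ ; φ-inj = Fin.↑ʳ-injective m _ _ ; adj-φ = adj-ʳʳ }

  private
    injˡ≢injʳ : ∀ {u v} → injˡ u ≢ injʳ v
    injˡ≢injʳ {u} {v} e with () ←
      ≡.trans (≡.sym (Fin.splitAt-↑ˡ m u n)) (≡.trans (cong (splitAt m) e) (Fin.splitAt-↑ʳ m n v))

    disjoint : ∀ {k} (c : Cycle G k) (d : Cycle H k) → ¬ (image ↪ˡ c ≋ image ↪ʳ d)
    disjoint c d e with Equivalence.to (e _ _) (edge (image ↪ˡ c) (proj₂ (next (first c))))
    ... | _ , _ , _ , inj₁ (p , _) = injˡ≢injʳ (≡.sym p)
    ... | _ , _ , _ , inj₂ (p , _) = injˡ≢injʳ (≡.sym p)

  -- No edge joins the two parts, so the part that contains the first vertex contains the next one,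
  -- and so on around the cycle.
  decompose : ∀ {k} (c : Cycle (G ∪ H) k) →
    (∃ λ d → image ↪ˡ d ≋ c) ⊎ (∃ λ d → image ↪ʳ d ≋ c)
  decompose c with vertex c (first c) in eq | side (vertex c (first c))
  ... | _ | left u = inj₁ (preimage ↪ˡ c (CyclicSuc-induction _ stepˡ (u , ≡.sym eq)))
    where
    stepˡ : ∀ {i j} → CyclicSuc i j → (∃ λ u → injˡ u ≡ vertex c i) → ∃ λ u → injˡ u ≡ vertex c j
    stepˡ {i} {j} i⟶j (u , p) with vertex c j in q | side (vertex c j)
    ... | _ | left v  = v , ≡.refl
    ... | _ | right v with () ← ≡.trans (≡.sym (adj-ˡʳ u v)) (≡.trans (cong₂ (adj (G ∪ H)) p (≡.sym q)) (adjacent c i j i⟶j))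
  ... | _ | right u = inj₂ (preimage ↪ʳ c (CyclicSuc-induction _ stepʳ (u , ≡.sym eq)))
    where
    stepʳ : ∀ {i j} → CyclicSuc i j → (∃ λ u → injʳ u ≡ vertex c i) → ∃ λ u → injʳ u ≡ vertex c j
    stepʳ {i} {j} i⟶j (u , p) with vertex c j in q | side (vertex c j)
    ... | _ | right v = v , ≡.refl
    ... | _ | left v with () ← ≡.trans (≡.sym (adj-ʳˡ u v)) (≡.trans (cong₂ (adj (G ∪ H)) p (≡.sym q)) (adjacent c i j i⟶j))

  count-∪ : ∀ {k N M} → CycleCount G k N → CycleCount H k M → CycleCount (G ∪ H) k (N + M)
  count-∪ {k} {N} {M} I J = count (f ∘ splitAt N)
    (λ i j e → ≡.trans (≡.sym (Fin.join-splitAt N M i))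
      (≡.trans (cong (join N M) (f-injective (splitAt N i) (splitAt N j) e))
      (Fin.join-splitAt N M j)))
    surjective
    where
    module I = Inverse I
    module J = Inverse J
    f : Fin N ⊎ Fin M → Cycle (G ∪ H) k
    f = [ image ↪ˡ ∘ I.from , image ↪ʳ ∘ J.from ]
    f-injective : ∀ s t → f s ≋ f t → s ≡ t
    f-injective (inj₁ i) (inj₁ j) e = cong inj₁ (≡.trans (≡.sym (I.strictlyInverseˡ i))
      (≡.trans (I.to-cong (image-injective ↪ˡ (I.from i) (I.from j) e)) (I.strictlyInverseˡ j)))
    f-injective (inj₂ i) (inj₂ j) e = cong inj₂ (≡.trans (≡.sym (J.strictlyInverseˡ i))
      (≡.trans (J.to-cong (image-injective ↪ʳ (J.from i) (J.from j) e)) (J.strictlyInverseˡ j)))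
    f-injective (inj₁ i) (inj₂ j) e = contradiction e (disjoint (I.from i) (J.from j))
    f-injective (inj₂ i) (inj₁ j) e =
      contradiction (≋-sym {x = image ↪ʳ (J.from i)} {y = image ↪ˡ (I.from j)} e) (disjoint (I.from j) (J.from i))
    surjective : ∀ c → ∃ λ i → f (splitAt N i) ≋ c
    surjective c with decompose c
    ... | inj₁ (d , e) = I.to d ↑ˡ M , subst (λ s → f s ≋ c) (≡.sym (Fin.splitAt-↑ˡ N (I.to d) M))
      (≋-trans {i = image ↪ˡ (I.from (I.to d))} {j = image ↪ˡ d} {k = c}
        (image-cong ↪ˡ (I.from (I.to d)) d (I.strictlyInverseʳ d)) e)
    ... | inj₂ (d , e) = N ↑ʳ J.to d , subst (λ s → f s ≋ c) (≡.sym (Fin.splitAt-↑ʳ N M (J.to d)))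
      (≋-trans {i = image ↪ʳ (J.from (J.to d))} {j = image ↪ʳ d} {k = c}
        (image-cong ↪ʳ (J.from (J.to d)) d (J.strictlyInverseʳ d)) e)

-- Cycles of paths and of cycle graphs

path-acyclic : ∀ n {k} → ¬ Cycle (path n) k
path-acyclic n c = descend _ (first c) ≡.refl
  where
  -- A vertex on a cycle has two distinct neighbours on it. At most one of them has a larger index
  -- along the path, so the other is smaller, and the indices would descend forever.
  descend : ∀ m i → toℕ (vertex c i) ≡ m → _
  descend m i eq with (j , l , i~j , i~l , j≢l) ← two-edges c i
    with PathGraph.adjacent⁻ n _ _ (HasEdge⇒Adjacent c i~j) | PathGraph.adjacent⁻ n _ _ (HasEdge⇒Adjacent c i~l)
  ... | inj₁ p | inj₁ q = j≢l (Fin.toℕ-injective (≡.trans (≡.sym p) q))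
  descend zero i eq | inj₂ p | _ = ℕ.1+n≢0 (≡.trans p eq)
  descend (suc m) i eq | inj₂ p | _ = descend m _ (ℕ.suc-injective (≡.trans p eq))
  descend zero i eq | inj₁ _ | inj₂ q = ℕ.1+n≢0 (≡.trans q eq)
  descend (suc m) i eq | inj₁ _ | inj₂ q = descend m _ (ℕ.suc-injective (≡.trans q eq))

module _ {n : ℕ} (3≤n : 3 ≤ n) where

  private
    C = cycle n 3≤n

  identityCycle : Cycle C n
  identityCycle = record
    { 3≤k = 3≤n
    ; vertex = id
    ; injective = id
    ; adjacent = λ i j i⟶j → CycleGraph.adjacent⁺ n 3≤n i j (inj₁ i⟶j)
    }

  module _ {k} (c : Cycle C k) where

    private
      -- The two distinct neighbours of `vertex c i` on `c` are also its neighbours in `C`, where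
      -- there are only the successor and the predecessor. Hence `c` runs on to the successor. Going
      -- around, `c` covers all vertices and edges of `C`, which fixes its length and its edge set.
      follow : ∀ i {v} → CyclicSuc (vertex c i) v → ∃ λ j → vertex c j ≡ v × HasEdge c (vertex c i) v
      follow i {v} i⟶v with (j , l , i~j , i~l , j≢l) ← two-edges c i
        with CycleGraph.adjacent⁻ n 3≤n _ _ (HasEdge⇒Adjacent c i~j)
           | CycleGraph.adjacent⁻ n 3≤n _ _ (HasEdge⇒Adjacent c i~l)
      ... | inj₁ p | _ = let eq = cyclicSuc-functional {k = v} p i⟶v in j , eq , subst (HasEdge c _) eq i~j
      ... | inj₂ p | inj₂ q = contradiction (cyclicSuc-injective p q) j≢l
      ... | inj₂ _ | inj₁ q = let eq = cyclicSuc-functional {k = v} q i⟶v in l , eq , subst (HasEdge c _) eq i~l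

      cover : ∀ v → ∃ λ i → vertex c i ≡ v
      cover = CyclicSuc-induction _
        (λ { u⟶v (i , ≡.refl) → let (j , eq , _) = follow i u⟶v in j , eq }) (first c , ≡.refl)

      cover-edge : ∀ {u v} → CyclicSuc u v → HasEdge c u v
      cover-edge {u} u⟶v with (i , ≡.refl) ← cover u = proj₂ (proj₂ (follow i u⟶v))

    cycle-length : k ≡ n
    cycle-length = ℕ.≤-antisym (Fin.injective⇒≤ (injective c)) (Fin.injective⇒≤ {f = proj₁ ∘ cover}
      λ {u} {v} e → ≡.trans (≡.sym (proj₂ (cover u))) (≡.trans (cong (vertex c) e) (proj₂ (cover v))))

    Adjacent⇒HasEdge : ∀ {u v} → Adjacent C u v → HasEdge c u v
    Adjacent⇒HasEdge {u} {v} u~v = [ cover-edge , HasEdge-sym c ∘ cover-edge ] (CycleGraph.adjacent⁻ n 3≤n u v u~v)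

  count-cycle : CycleCount C n 1
  count-cycle = count-1 identityCycle λ d u v → mk⇔
    (Adjacent⇒HasEdge d ∘ HasEdge⇒Adjacent identityCycle)
    (Adjacent⇒HasEdge identityCycle ∘ HasEdge⇒Adjacent d)

  count-cycle-≢ : ∀ {k} → k ≢ n → CycleCount C k 0
  count-cycle-≢ k≢n = count-0 λ c → k≢n (cycle-length c)

-- Girth and counting functions

GirthAtLeast : ℕ → Graph → Set
GirthAtLeast g G = ∀ k → Cycle G k → g ≤ k

girth-∪ : ∀ {g} G H → GirthAtLeast g G → GirthAtLeast g H → GirthAtLeast g (G ∪ H)
girth-∪ G H p q k c = [ p k ∘ proj₁ , q k ∘ proj₁ ] (decompose G H c)

girth-path : ∀ {g} n → GirthAtLeast g (path n)
girth-path n k c = contradiction c (path-acyclic n)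

girth-cycle : ∀ {g} n 3≤n → g ≤ n → GirthAtLeast g (cycle n 3≤n)
girth-cycle n 3≤n g≤n k c = ℕ.≤-trans g≤n (ℕ.≤-reflexive (≡.sym (cycle-length 3≤n c)))

girth-cycle∪paths : ∀ {g} n 3≤n m → g ≤ n → GirthAtLeast g (cycle∪paths n 3≤n m)
girth-cycle∪paths n 3≤n m g≤n = girth-∪ (cycle n 3≤n) (path m ∪ path m) (girth-cycle n 3≤n g≤n)
  (girth-∪ (path m) (path m) (girth-path m) (girth-path m))

δ : ℕ → ℕ → ℕ
δ n k with k ≟ n
... | yes _ = 1
... | no  _ = 0

δ-≡ : ∀ n → δ n n ≡ 1
δ-≡ n with n ≟ n
... | yes _   = ≡.refl
... | no  n≢n = contradiction ≡.refl n≢n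

δ-≢ : ∀ {n k} → k ≢ n → δ n k ≡ 0
δ-≢ {n} {k} k≢n with k ≟ n
... | yes k≡n = contradiction k≡n k≢n
... | no  _   = ≡.refl

CountedBy : Graph → (ℕ → ℕ) → Set
CountedBy G N = ∀ k → CycleCount G k (N k)

counted-cycle : ∀ n 3≤n → CountedBy (cycle n 3≤n) (δ n)
counted-cycle n 3≤n k with k ≟ n
... | yes ≡.refl = count-cycle 3≤n
... | no  k≢n    = count-cycle-≢ 3≤n k≢n

counted-cycle∪paths : ∀ n 3≤n m k → CycleCount (cycle∪paths n 3≤n m) k (δ n k + 0)
counted-cycle∪paths n 3≤n m k = count-∪ _ _ (counted-cycle n 3≤n k)
  (count-∪ (path m) (path m) (count-0 (path-acyclic m)) (count-0 (path-acyclic m)))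

-- Subspaces of coordinate spaces

module R = CommutativeRing ℝ-commutativeRing
open import Relation.Binary.Reasoning.Setoid R.setoid

-- Rational coefficients allow the solver to compute with ½ and ¼. The two sides of each law share
-- the underlying sequence and differ only in the Cauchy proof, so `close` of reflexivity can be
-- wrapped again.
ℚ⟶ℝ : ℚ.+-*-rawRing -Raw-AlmostCommutative⟶ fromCommutativeRing ℝ-commutativeRing
ℚ⟶ℝ = record
  { ⟦_⟧    = fromℚ
  ; +-homo = λ p q → mk≈ (close (R.refl {fromℚ (p ℚ.+ q)}))
  ; *-homo = λ p q → mk≈ (close (R.refl {fromℚ (p ℚ.* q)}))
  ; -‿homo = λ p → mk≈ (close (R.refl {fromℚ (ℚ.- p)}))
  ; 0-homo = R.refl
  ; 1-homo = R.refl
  }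

fromℚ≟ : ∀ p q → Maybe (fromℚ p ≈ᴿ fromℚ q)
fromℚ≟ p q with p ℚ.≟ q
... | yes p≡q = just (R.reflexive (cong fromℚ p≡q))
... | no  _   = nothing

open RingSolver ℚ.+-*-rawRing (fromCommutativeRing ℝ-commutativeRing) ℚ⟶ℝ fromℚ≟
  using (solve; _:=_; con; _:+_; _:*_; _:-_; :-_)

infix 4 _⊸_ _≅_
infixr 6 _⊕_

record _⊸_ (I J : Set) : Set where
  field
    ap     : (I → ℝ) → (J → ℝ)
    cong≈  : ∀ {x y} → (∀ i → x i ≈ᴿ y i) → ∀ j → ap x j ≈ᴿ ap y j
    +-homo : ∀ x y j → ap (λ i → x i +ᴿ y i) j ≈ᴿ ap x j +ᴿ ap y j
    *-homo : ∀ c x j → ap (λ i → c *ᴿ x i) j ≈ᴿ c *ᴿ ap x j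

open _⊸_

-- A predicate on vectors over an arbitrary index type covers eigenspaces, annihilators in ℝ and
-- direct sums alike.
record Subspace : Set₁ where
  no-eta-equality
  field
    Index : Set
    _∋_   : (Index → ℝ) → Set

open Subspace

-- The maps are linear on the whole coordinate spaces, but inverse to each other only on the
-- subspaces. No type of elements of a subspace has to be formed.
record _≅_ (V W : Subspace) : Set where
  field
    to      : Index V ⊸ Index W
    from    : Index W ⊸ Index V
    to∈     : ∀ {x} → V ∋ x → W ∋ ap to x
    from∈   : ∀ {y} → W ∋ y → V ∋ ap from y
    from∘to : ∀ {x} → V ∋ x → ∀ i → ap from (ap to x) i ≈ᴿ x i
    to∘from : ∀ {y} → W ∋ y → ∀ j → ap to (ap from y) j ≈ᴿ y j

open _≅_

_⊕_ : Subspace → Subspace → Subspace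
(V ⊕ W) .Index = Index V ⊎ Index W
(V ⊕ W) ._∋_ x = V ∋ (x ∘ inj₁) × W ∋ (x ∘ inj₂)

reindex : ∀ {I J} → (J → I) → I ⊸ J
reindex f .ap x = x ∘ f
reindex f .cong≈ x≈y j = x≈y (f j)
reindex f .+-homo x y j = R.refl
reindex f .*-homo c x j = R.refl

_⊸∘_ : ∀ {I J K} → J ⊸ K → I ⊸ J → I ⊸ K
(f ⊸∘ g) .ap x = ap f (ap g x)
(f ⊸∘ g) .cong≈ x≈y = cong≈ f (cong≈ g x≈y)
(f ⊸∘ g) .+-homo x y k = R.trans (cong≈ f (+-homo g x y) k) (+-homo f (ap g x) (ap g y) k)
(f ⊸∘ g) .*-homo c x k = R.trans (cong≈ f (*-homo g c x) k) (*-homo f c (ap g x) k)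

_⊸⊕_ : ∀ {I J K L} → I ⊸ K → J ⊸ L → (I ⊎ J) ⊸ (K ⊎ L)
(f ⊸⊕ g) .ap x = [ ap f (x ∘ inj₁) , ap g (x ∘ inj₂) ]
(f ⊸⊕ g) .cong≈ x≈y (inj₁ k) = cong≈ f (x≈y ∘ inj₁) k
(f ⊸⊕ g) .cong≈ x≈y (inj₂ l) = cong≈ g (x≈y ∘ inj₂) l
(f ⊸⊕ g) .+-homo x y (inj₁ k) = +-homo f (x ∘ inj₁) (y ∘ inj₁) k
(f ⊸⊕ g) .+-homo x y (inj₂ l) = +-homo g (x ∘ inj₂) (y ∘ inj₂) l
(f ⊸⊕ g) .*-homo c x (inj₁ k) = *-homo f c (x ∘ inj₁) k
(f ⊸⊕ g) .*-homo c x (inj₂ l) = *-homo g c (x ∘ inj₂) l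

≅-refl : ∀ {V} → V ≅ V
≅-refl .to = reindex λ i → i
≅-refl .from = reindex λ i → i
≅-refl .to∈ x∈ = x∈
≅-refl .from∈ x∈ = x∈
≅-refl .from∘to _ _ = R.refl
≅-refl .to∘from _ _ = R.refl

≅-sym : ∀ {V W} → V ≅ W → W ≅ V
≅-sym f = record
  { to = from f ; from = to f ; to∈ = from∈ f ; from∈ = to∈ f
  ; from∘to = to∘from f ; to∘from = from∘to f }

≅-trans : ∀ {U V W} → U ≅ V → V ≅ W → U ≅ W
≅-trans f g .to = to g ⊸∘ to f
≅-trans f g .from = from f ⊸∘ from g
≅-trans f g .to∈ = to∈ g ∘ to∈ f
≅-trans f g .from∈ = from∈ f ∘ from∈ g
≅-trans f g .from∘to x∈ i = R.trans (cong≈ (from f) (from∘to g (to∈ f x∈)) i) (from∘to f x∈ i)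
≅-trans f g .to∘from y∈ j = R.trans (cong≈ (to g) (to∘from f (from∈ g y∈)) j) (to∘from g y∈ j)

⊕-cong : ∀ {U V W X} → U ≅ W → V ≅ X → (U ⊕ V) ≅ (W ⊕ X)
⊕-cong f g .to = to f ⊸⊕ to g
⊕-cong f g .from = from f ⊸⊕ from g
⊕-cong f g .to∈ (x∈ , y∈) = to∈ f x∈ , to∈ g y∈
⊕-cong f g .from∈ (x∈ , y∈) = from∈ f x∈ , from∈ g y∈
⊕-cong f g .from∘to (x∈ , y∈) = λ { (inj₁ i) → from∘to f x∈ i ; (inj₂ j) → from∘to g y∈ j }
⊕-cong f g .to∘from (x∈ , y∈) = λ { (inj₁ i) → to∘from f x∈ i ; (inj₂ j) → to∘from g y∈ j }

-- Eigenspaces and multiplicities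

Eigenspace : Graph → ℝ → Subspace
Eigenspace G μ .Index = Vertex G
Eigenspace G μ ._∋_ = IsEigenvector G μ

combination-homo : ∀ {m n k} (f : Fin n ⊸ Fin k) c (b : Fin m → Vector ℝ n) →
  ∀ u → combination c (ap f ∘ b) u ≈ᴿ ap f (combination c b) u
combination-homo {zero} f c b u = begin
  0ℝ                            ≈⟨ R.zeroˡ _ ⟨
  0ℝ *ᴿ ap f (λ _ → 0ℝ) u       ≈⟨ *-homo f 0ℝ (λ _ → 0ℝ) u ⟨
  ap f (λ _ → 0ℝ *ᴿ 0ℝ) u       ≈⟨ cong≈ f (λ _ → R.zeroˡ 0ℝ) u ⟩
  ap f (λ _ → 0ℝ) u             ∎
combination-homo {suc m} f c b u = begin
  c zero *ᴿ ap f (b zero) u +ᴿ combination (c ∘ suc) (ap f ∘ b ∘ suc) u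
    ≈⟨ R.+-cong (R.sym (*-homo f (c zero) (b zero) u)) (combination-homo f (c ∘ suc) (b ∘ suc) u) ⟩
  ap f (λ v → c zero *ᴿ b zero v) u +ᴿ ap f (combination (c ∘ suc) (b ∘ suc)) u
    ≈⟨ +-homo f _ _ u ⟨
  ap f (combination c b) u ∎

ap-0 : ∀ {I J} (f : I ⊸ J) {x} → (∀ i → x i ≈ᴿ 0ℝ) → ∀ j → ap f x j ≈ᴿ 0ℝ
ap-0 f {x} x≈0 j = begin
  ap f x j                  ≈⟨ cong≈ f (λ i → R.trans (x≈0 i) (R.sym (R.zeroˡ 0ℝ))) j ⟩
  ap f (λ _ → 0ℝ *ᴿ 0ℝ) j   ≈⟨ *-homo f 0ℝ (λ _ → 0ℝ) j ⟩
  0ℝ *ᴿ ap f (λ _ → 0ℝ) j   ≈⟨ R.zeroˡ _ ⟩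
  0ℝ                        ∎

combination-congʳ : ∀ {m n} (c : Vector ℝ m) {b b′ : Fin m → Vector ℝ n} →
  (∀ j u → b j u ≈ᴿ b′ j u) → ∀ u → combination c b u ≈ᴿ combination c b′ u
combination-congʳ c b≈b′ u = sum-cong-≋ λ j → R.*-congˡ (b≈b′ j u)

multiplicity-cong : ∀ {G H μ m} → Eigenspace G μ ≅ Eigenspace H μ →
  HasMultiplicity G μ m → HasMultiplicity H μ m
multiplicity-cong f g = record
  { basis = λ j → ap (to f) (basis j)
  ; eigen = λ j → to∈ f (eigen j)
  ; independent = λ c c≈0 → independent c λ u → begin
      combination c basis u
        ≈⟨ combination-congʳ c (λ j u → from∘to f (eigen j) u) u ⟨
      combination c (ap (from f) ∘ ap (to f) ∘ basis) u
        ≈⟨ combination-homo (from f) c (ap (to f) ∘ basis) u ⟩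
      ap (from f) (combination c (ap (to f) ∘ basis)) u
        ≈⟨ ap-0 (from f) c≈0 u ⟩
      0ℝ ∎
  ; spanning = λ y y∈ → let (c , eq) = spanning (ap (from f) y) (from∈ f y∈) in
      c , λ u → begin
        y u                                   ≈⟨ to∘from f y∈ u ⟨
        ap (to f) (ap (from f) y) u           ≈⟨ cong≈ (to f) eq u ⟩
        ap (to f) (combination c basis) u     ≈⟨ combination-homo (to f) c basis u ⟨
        combination c (ap (to f) ∘ basis) u   ∎
  }
  where open HasMultiplicity g

SimilarGraphs : Graph → Graph → Set
SimilarGraphs G H = ∀ μ → Eigenspace G μ ≅ Eigenspace H μ

similar⇒sameSpectrum : ∀ {G H} → SimilarGraphs G H → SameSpectrum G H
similar⇒sameSpectrum f μ m = mk⇔ (multiplicity-cong (f μ)) (multiplicity-cong (≅-sym (f μ)))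

-- Annihilators

Ann : ℝ → Subspace
Ann a .Index = ⊤
Ann a ._∋_ x = a *ᴿ x tt ≈ᴿ 0ℝ

Ann-cong : ∀ {a b} → a ≈ᴿ b → Ann a ≅ Ann b
Ann-cong a≈b .to = reindex λ i → i
Ann-cong a≈b .from = reindex λ i → i
Ann-cong a≈b .to∈ x∈ = R.trans (R.*-congʳ (R.sym a≈b)) x∈
Ann-cong a≈b .from∈ x∈ = R.trans (R.*-congʳ a≈b) x∈
Ann-cong a≈b .from∘to _ _ = R.refl
Ann-cong a≈b .to∘from _ _ = R.refl

-- The Chinese remainder theorem: on the annihilator of `a *ᴿ b`, multiplication by `β *ᴿ b` and by
-- `α *ᴿ a` are complementary projections, onto `Ann a` and `Ann b`.
Ann-* : ∀ a b α β → α *ᴿ a +ᴿ β *ᴿ b ≈ᴿ 1ℝ → Ann (a *ᴿ b) ≅ (Ann a ⊕ Ann b)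
Ann-* a b α β bezout = record
  { to = record
    { ap     = λ { x (inj₁ _) → β *ᴿ b *ᴿ x tt ; x (inj₂ _) → α *ᴿ a *ᴿ x tt }
    ; cong≈  = λ { x≈y (inj₁ _) → R.*-congˡ (x≈y tt) ; x≈y (inj₂ _) → R.*-congˡ (x≈y tt) }
    ; +-homo = λ { x y (inj₁ _) → R.distribˡ _ _ _ ; x y (inj₂ _) → R.distribˡ _ _ _ }
    ; *-homo = λ { c x (inj₁ _) → comm′ (β *ᴿ b) c (x tt) ; c x (inj₂ _) → comm′ (α *ᴿ a) c (x tt) }
    }
  ; from = record
    { ap     = λ y _ → y (inj₁ tt) +ᴿ y (inj₂ tt)
    ; cong≈  = λ x≈y _ → R.+-cong (x≈y (inj₁ tt)) (x≈y (inj₂ tt))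
    ; +-homo = λ x y _ → solve 4 (λ p q r s → (p :+ q) :+ (r :+ s) := (p :+ r) :+ (q :+ s)) R.refl
                 (x (inj₁ tt)) (y (inj₁ tt)) (x (inj₂ tt)) (y (inj₂ tt))
    ; *-homo = λ c x _ → R.sym (R.distribˡ c _ _)
    }
  ; to∈ = λ {x} abx → kill β abx (solve 4 (λ a b β x → a :* (β :* b :* x) := β :* (a :* b :* x)) R.refl a b β (x tt))
                    , kill α abx (solve 4 (λ a b α x → b :* (α :* a :* x) := α :* (a :* b :* x)) R.refl a b α (x tt))
  ; from∈ = λ {y} (ay , bz) → begin
      a *ᴿ b *ᴿ (y (inj₁ tt) +ᴿ y (inj₂ tt))
        ≈⟨ solve 4 (λ a b y z → a :* b :* (y :+ z) := b :* (a :* y) :+ a :* (b :* z)) R.refl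
             a b (y (inj₁ tt)) (y (inj₂ tt)) ⟩
      b *ᴿ (a *ᴿ y (inj₁ tt)) +ᴿ a *ᴿ (b *ᴿ y (inj₂ tt))
        ≈⟨ R.+-cong (R.*-congˡ ay) (R.*-congˡ bz) ⟩
      b *ᴿ 0ℝ +ᴿ a *ᴿ 0ℝ
        ≈⟨ solve 2 (λ a b → b :* con 0ℚ :+ a :* con 0ℚ := con 0ℚ) R.refl a b ⟩
      0ℝ ∎
  ; from∘to = λ {x} _ _ → begin
      β *ᴿ b *ᴿ x tt +ᴿ α *ᴿ a *ᴿ x tt
        ≈⟨ solve 5 (λ a b α β x → β :* b :* x :+ α :* a :* x := (α :* a :+ β :* b) :* x) R.refl a b α β (x tt) ⟩
      (α *ᴿ a +ᴿ β *ᴿ b) *ᴿ x tt  ≈⟨ R.*-congʳ bezout ⟩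
      1ℝ *ᴿ x tt                  ≈⟨ R.*-identityˡ _ ⟩
      x tt                        ∎
  ; to∘from = λ {y} (ay , bz) → λ
      { (inj₁ _) → begin
          β *ᴿ b *ᴿ (y (inj₁ tt) +ᴿ y (inj₂ tt))
            ≈⟨ solve 6 (λ a b α β y z → β :* b :* (y :+ z) :=
                 (α :* a :+ β :* b) :* y :+ (β :* (b :* z) :- α :* (a :* y))) R.refl a b α β (y (inj₁ tt)) (y (inj₂ tt)) ⟩
          (α *ᴿ a +ᴿ β *ᴿ b) *ᴿ y (inj₁ tt) +ᴿ (β *ᴿ (b *ᴿ y (inj₂ tt)) R.- α *ᴿ (a *ᴿ y (inj₁ tt)))
            ≈⟨ R.+-cong (R.*-congʳ bezout) (R.+-cong (R.*-congˡ bz) (R.-‿cong (R.*-congˡ ay))) ⟩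
          1ℝ *ᴿ y (inj₁ tt) +ᴿ (β *ᴿ 0ℝ R.- α *ᴿ 0ℝ)
            ≈⟨ solve 3 (λ α β y → con 1ℚ :* y :+ (β :* con 0ℚ :- α :* con 0ℚ) := y) R.refl α β (y (inj₁ tt)) ⟩
          y (inj₁ tt) ∎
      ; (inj₂ _) → begin
          α *ᴿ a *ᴿ (y (inj₁ tt) +ᴿ y (inj₂ tt))
            ≈⟨ solve 6 (λ a b α β y z → α :* a :* (y :+ z) :=
                 (α :* a :+ β :* b) :* z :+ (α :* (a :* y) :- β :* (b :* z))) R.refl a b α β (y (inj₁ tt)) (y (inj₂ tt)) ⟩
          (α *ᴿ a +ᴿ β *ᴿ b) *ᴿ y (inj₂ tt) +ᴿ (α *ᴿ (a *ᴿ y (inj₁ tt)) R.- β *ᴿ (b *ᴿ y (inj₂ tt)))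
            ≈⟨ R.+-cong (R.*-congʳ bezout) (R.+-cong (R.*-congˡ ay) (R.-‿cong (R.*-congˡ bz))) ⟩
          1ℝ *ᴿ y (inj₂ tt) +ᴿ (α *ᴿ 0ℝ R.- β *ᴿ 0ℝ)
            ≈⟨ solve 3 (λ α β y → con 1ℚ :* y :+ (α :* con 0ℚ :- β :* con 0ℚ) := y) R.refl α β (y (inj₂ tt)) ⟩
          y (inj₂ tt) ∎
      }
  }
  where
  comm′ : ∀ a c x → a *ᴿ (c *ᴿ x) ≈ᴿ c *ᴿ (a *ᴿ x)
  comm′ = solve 3 (λ a c x → a :* (c :* x) := c :* (a :* x)) R.refl
  kill : ∀ c {x y} → x ≈ᴿ 0ℝ → y ≈ᴿ c *ᴿ x → y ≈ᴿ 0ℝ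
  kill c x≈0 y≈cx = R.trans y≈cx (R.trans (R.*-congˡ x≈0) (R.zeroʳ c))

-- Eigenspaces of unions

value : ∀ {A : Set} (x : A → ℝ) {u v} → u ≡ v → x u ≈ᴿ x v
value x eq = R.reflexive (cong x eq)

∑ : List ℝ → ℝ
∑ = foldr _+ᴿ_ 0ℝ

∑-↭ : ∀ {xs ys} → xs ↭ ys → ∑ xs ≈ᴿ ∑ ys
∑-↭ p = Permutation.foldr-commMonoid R.setoid R.+-isCommutativeMonoid (↭⇒↭ₛ′ R.isEquivalence p)

-- Only `f = id` is used; the general `f` lets the induction pass to `f ∘ suc`.
sum-filter : ∀ {m n} (p : Fin m → Bool) (f : Fin n → Fin m) x →
  sum (λ i → (if p (f i) then 1ℝ else 0ℝ) *ᴿ x (f i)) ≈ᴿ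
  ∑ (map x (filter (λ v → p v 𝔹.≟ true) (tabulate f)))
sum-filter {n = zero} p f x = R.refl
sum-filter {n = suc n} p f x with p (f zero)
... | true  = R.+-cong (R.*-identityˡ _) (sum-filter p (f ∘ suc) x)
... | false = R.trans (R.+-cong (R.zeroˡ _) (sum-filter p (f ∘ suc) x)) (R.+-identityˡ _)

sum-neighbours : ∀ G u x {vs} → neighbours G u ↭ vs →
  sum (λ v → adjacencyMatrix G u v *ᴿ x v) ≈ᴿ ∑ (map x vs)
sum-neighbours G u x p = R.trans (sum-filter (adj G u) id x) (∑-↭ (map⁺ x p))

module _ (G H : Graph) where
  open Union G H

  sum-∪ : ∀ (t : Vertex (G ∪ H) → ℝ) → sum t ≈ᴿ sum (t ∘ injˡ) +ᴿ sum (t ∘ injʳ)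
  sum-∪ = go m
    where
    go : ∀ m {n} (t : Fin (m + n) → ℝ) → sum t ≈ᴿ sum (t ∘ (_↑ˡ n)) +ᴿ sum (t ∘ (m ↑ʳ_))
    go zero t = R.sym (R.+-identityˡ _)
    go (suc m) t = R.trans (R.+-congˡ (go m (t ∘ suc))) (R.sym (R.+-assoc _ _ _))

  private
    sum-0 : ∀ {k} (t : Fin k → ℝ) → (∀ i → t i ≈ᴿ 0ℝ) → sum t ≈ᴿ 0ℝ
    sum-0 {zero} t t≈0 = R.refl
    sum-0 {suc k} t t≈0 = R.trans (R.+-cong (t≈0 zero) (sum-0 (t ∘ suc) (t≈0 ∘ suc))) (R.+-identityˡ _)

    entry : ∀ {b c} x → b ≡ c → (if b then 1ℝ else 0ℝ) *ᴿ x ≈ᴿ (if c then 1ℝ else 0ℝ) *ᴿ x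
    entry x ≡.refl = R.refl

  sum-ˡ : ∀ (x : Vertex (G ∪ H) → ℝ) u → sum (λ v → adjacencyMatrix (G ∪ H) (injˡ u) v *ᴿ x v) ≈ᴿ
                  sum (λ v → adjacencyMatrix G u v *ᴿ x (injˡ v))
  sum-ˡ x u = R.trans (sum-∪ (λ v → adjacencyMatrix (G ∪ H) (injˡ u) v *ᴿ x v)) (R.trans
    (R.+-cong (sum-cong-≋ λ v → entry (x (injˡ v)) (adj-ˡˡ u v))
              (sum-0 _ λ v → R.trans (entry (x (injʳ v)) (adj-ˡʳ u v)) (R.zeroˡ _)))
    (R.+-identityʳ _))

  sum-ʳ : ∀ (x : Vertex (G ∪ H) → ℝ) u → sum (λ v → adjacencyMatrix (G ∪ H) (injʳ u) v *ᴿ x v) ≈ᴿ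
                  sum (λ v → adjacencyMatrix H u v *ᴿ x (injʳ v))
  sum-ʳ x u = R.trans (sum-∪ (λ v → adjacencyMatrix (G ∪ H) (injʳ u) v *ᴿ x v)) (R.trans
    (R.+-cong (sum-0 _ λ v → R.trans (entry (x (injˡ v)) (adj-ʳˡ u v)) (R.zeroˡ _))
              (sum-cong-≋ λ v → entry (x (injʳ v)) (adj-ʳʳ u v)))
    (R.+-identityˡ _))

  eigenspace-∪ : ∀ μ → Eigenspace (G ∪ H) μ ≅ (Eigenspace G μ ⊕ Eigenspace H μ)
  eigenspace-∪ μ .to = reindex (join m n)
  eigenspace-∪ μ .from = reindex (splitAt m)
  eigenspace-∪ μ .to∈ {x} x∈ = (λ u → R.trans (R.sym (sum-ˡ x u)) (x∈ (injˡ u)))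
                             , (λ u → R.trans (R.sym (sum-ʳ x u)) (x∈ (injʳ u)))
  eigenspace-∪ μ .from∈ {y} (yˡ∈ , yʳ∈) u with side u
  ... | left v = begin
    sum (λ w → adjacencyMatrix (G ∪ H) (injˡ v) w *ᴿ y (splitAt m w))
      ≈⟨ sum-ˡ (y ∘ splitAt m) v ⟩
    sum (λ w → adjacencyMatrix G v w *ᴿ y (splitAt m (injˡ w)))
      ≈⟨ sum-cong-≋ (λ w → R.*-congˡ (value y (Fin.splitAt-↑ˡ m w n))) ⟩
    sum (λ w → adjacencyMatrix G v w *ᴿ y (inj₁ w))
      ≈⟨ yˡ∈ v ⟩
    μ *ᴿ y (inj₁ v)
      ≈⟨ R.*-congˡ (value y (Fin.splitAt-↑ˡ m v n)) ⟨
    μ *ᴿ y (splitAt m (injˡ v)) ∎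
  ... | right v = begin
    sum (λ w → adjacencyMatrix (G ∪ H) (injʳ v) w *ᴿ y (splitAt m w))
      ≈⟨ sum-ʳ (y ∘ splitAt m) v ⟩
    sum (λ w → adjacencyMatrix H v w *ᴿ y (splitAt m (injʳ w)))
      ≈⟨ sum-cong-≋ (λ w → R.*-congˡ (value y (Fin.splitAt-↑ʳ m n w))) ⟩
    sum (λ w → adjacencyMatrix H v w *ᴿ y (inj₂ w))
      ≈⟨ yʳ∈ v ⟩
    μ *ᴿ y (inj₂ v)
      ≈⟨ R.*-congˡ (value y (Fin.splitAt-↑ʳ m n v)) ⟨
    μ *ᴿ y (splitAt m (injʳ v)) ∎
  eigenspace-∪ μ .from∘to {x} _ u = value x (Fin.join-splitAt m n u)
  eigenspace-∪ μ .to∘from {y} _ u = value y (Fin.splitAt-join m n u)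

similar-∪ : ∀ {G G′ H H′} → SimilarGraphs G G′ → SimilarGraphs H H′ → SimilarGraphs (G ∪ H) (G′ ∪ H′)
similar-∪ {G} {G′} {H} {H′} f g μ =
  ≅-trans (eigenspace-∪ G H μ) (≅-trans (⊕-cong (f μ) (g μ)) (≅-sym (eigenspace-∪ G′ H′ μ)))

-- The Chebyshev polynomials s_k(2 cos θ) = sin kθ / sin θ

s : ℝ → ℕ → ℝ
s μ 0 = 0ℝ
s μ 1 = 1ℝ
s μ (suc (suc k)) = μ *ᴿ s μ (suc k) R.- s μ k

2ℝ 4ℝ ½ℝ ¼ℝ : ℝ
2ℝ = fromℚ (1ℚ ℚ.+ 1ℚ)
4ℝ = fromℚ ((1ℚ ℚ.+ 1ℚ) ℚ.+ (1ℚ ℚ.+ 1ℚ))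
½ℝ = fromℚ ½
¼ℝ = fromℚ (½ ℚ.* ½)

-- For fixed `n` both sides satisfy, as functions of `m`, the recurrence that defines `s`, so
-- agreement at 0 and 1 suffices.
s-+ : ∀ μ m n → s μ (suc (m + n)) ≈ᴿ s μ (suc m) *ᴿ s μ (suc n) R.- s μ m *ᴿ s μ n
s-+ μ 0 n = solve 2 (λ x y → x := con 1ℚ :* x :- con 0ℚ :* y) R.refl (s μ (suc n)) (s μ n)
s-+ μ 1 n = solve 3 (λ μ x y → μ :* x :- y := (μ :* con 1ℚ :- con 0ℚ) :* x :- con 1ℚ :* y) R.refl
  μ (s μ (suc n)) (s μ n)
s-+ μ (suc (suc m)) n = begin
  μ *ᴿ s μ (suc (suc m + n)) R.- s μ (suc (m + n))
    ≈⟨ R.+-cong (R.*-congˡ (s-+ μ (suc m) n)) (R.-‿cong (s-+ μ m n)) ⟩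
  μ *ᴿ (s μ (2 + m) *ᴿ Z R.- X *ᴿ s μ n) R.- (X *ᴿ Z R.- s μ m *ᴿ s μ n)
    ≈⟨ solve 5 (λ μ x w z n → μ :* ((μ :* x :- w) :* z :- x :* n) :- (x :* z :- w :* n) :=
         (μ :* (μ :* x :- w) :- x) :* z :- (μ :* x :- w) :* n) R.refl μ X (s μ m) Z (s μ n) ⟩
  s μ (3 + m) *ᴿ Z R.- s μ (2 + m) *ᴿ s μ n ∎
  where
  X = s μ (suc m)
  Z = s μ (suc n)

-- A quadratic form invariant under the step from (W, X) to (X, μX - W). At (s_k, s_{k+1}) it is the
-- determinant of the k-th power of the transfer matrix, hence 1.
casoratian : ℝ → ℝ → ℝ → ℝ
casoratian μ W X = (X *ᴿ X R.- μ *ᴿ (W *ᴿ X)) +ᴿ W *ᴿ W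

s-casoratian : ∀ μ k → casoratian μ (s μ k) (s μ (suc k)) ≈ᴿ 1ℝ
s-casoratian μ 0 = solve 1 (λ μ → (con 1ℚ :* con 1ℚ :- μ :* (con 0ℚ :* con 1ℚ)) :+ con 0ℚ :* con 0ℚ := con 1ℚ) R.refl μ
s-casoratian μ (suc k) = R.trans
  (solve 3 (λ μ w x → let y = μ :* x :- w in
    (y :* y :- μ :* (x :* y)) :+ x :* x := (x :* x :- μ :* (w :* x)) :+ w :* w) R.refl μ (s μ k) (s μ (suc k)))
  (s-casoratian μ k)

-- w and v are 4 sin² θ and 2 cos kθ.
w : ℝ → ℝ
w μ = 4ℝ R.- μ *ᴿ μ

v : ℝ → ℕ → ℝ
v μ k = 2ℝ *ᴿ s μ (suc k) R.- μ *ᴿ s μ k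

s-double : ∀ μ k → s μ (k + k) ≈ᴿ s μ k *ᴿ v μ k
s-double μ zero = R.sym (R.zeroˡ _)
s-double μ (suc j) = R.trans (s-+ μ j (suc j))
  (solve 3 (λ μ w x → x :* (μ :* x :- w) :- w :* x :=
    x :* (con (1ℚ ℚ.+ 1ℚ) :* (μ :* x :- w) :- μ :* x)) R.refl μ (s μ j) (s μ (suc j)))

-- This is (2 cos kθ)² + (2 sin kθ)² = 4, and as a polynomial identity it is four times
-- `s-casoratian`. A quarter of it is the Bézout relation by which the annihilators below split.
pythagoras : ∀ μ k → v μ k *ᴿ v μ k +ᴿ w μ *ᴿ (s μ k *ᴿ s μ k) ≈ᴿ 4ℝ
pythagoras μ k = R.trans
  (solve 3 (λ μ w x → let v = con (1ℚ ℚ.+ 1ℚ) :* x :- μ :* w ; 4c = con ((1ℚ ℚ.+ 1ℚ) ℚ.+ (1ℚ ℚ.+ 1ℚ)) in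
    v :* v :+ (4c :- μ :* μ) :* (w :* w) := 4c :* ((x :* x :- μ :* (w :* x)) :+ w :* w))
    R.refl μ (s μ k) (s μ (suc k)))
  (R.trans (R.*-congˡ (s-casoratian μ k)) (R.*-identityʳ 4ℝ))

-- The solution of f (k + 2) = μ f (k + 1) - f k with f 0 = a and f 1 = b.
solution : ℝ → ℝ → ℝ → ℕ → ℝ
solution μ a b zero    = a
solution μ a b (suc k) = s μ (suc k) *ᴿ b R.- s μ k *ᴿ a

solution-1 : ∀ μ a b → solution μ a b 1 ≈ᴿ b
solution-1 = solve 3 (λ μ a b → con 1ℚ :* b :- con 0ℚ :* a := b) R.refl

solution-recurrence : ∀ μ a b k →
  solution μ a b k +ᴿ solution μ a b (2 + k) ≈ᴿ μ *ᴿ solution μ a b (suc k)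
solution-recurrence μ a b zero =
  solve 3 (λ μ a b → a :+ ((μ :* con 1ℚ :- con 0ℚ) :* b :- con 1ℚ :* a) :=
    μ :* (con 1ℚ :* b :- con 0ℚ :* a)) R.refl μ a b
solution-recurrence μ a b (suc k) =
  solve 5 (λ μ a b x w → (x :* b :- w :* a) :+ ((μ :* (μ :* x :- w) :- x) :* b :- (μ :* x :- w) :* a) :=
    μ :* ((μ :* x :- w) :* b :- x :* a)) R.refl μ a b (s μ (suc k)) (s μ k)

solution-cong : ∀ μ {a a′ b b′} → a ≈ᴿ a′ → b ≈ᴿ b′ → ∀ k → solution μ a b k ≈ᴿ solution μ a′ b′ k
solution-cong μ a≈ b≈ zero = a≈
solution-cong μ a≈ b≈ (suc k) = R.+-cong (R.*-congˡ b≈) (R.-‿cong (R.*-congˡ a≈))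

solution-+ : ∀ μ a b c d k → solution μ (a +ᴿ c) (b +ᴿ d) k ≈ᴿ solution μ a b k +ᴿ solution μ c d k
solution-+ μ a b c d zero = R.refl
solution-+ μ a b c d (suc k) =
  solve 6 (λ a b c d x w → x :* (b :+ d) :- w :* (a :+ c) := (x :* b :- w :* a) :+ (x :* d :- w :* c)) R.refl
    a b c d (s μ (suc k)) (s μ k)

solution-* : ∀ μ c a b k → solution μ (c *ᴿ a) (c *ᴿ b) k ≈ᴿ c *ᴿ solution μ a b k
solution-* μ c a b zero = R.refl
solution-* μ c a b (suc k) =
  solve 5 (λ c a b x w → x :* (c :* b) :- w :* (c :* a) := c :* (x :* b :- w :* a)) R.refl
    c a b (s μ (suc k)) (s μ k)

private
  step : ∀ {μ x y z} → x +ᴿ z ≈ᴿ μ *ᴿ y → z ≈ᴿ μ *ᴿ y R.- x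
  step {x = x} {z = z} eq = R.trans (solve 2 (λ x z → z := (x :+ z) :- x) R.refl x z) (R.+-congʳ eq)

solution-unique : ∀ μ (f : ℕ → ℝ) → (∀ k → f k +ᴿ f (2 + k) ≈ᴿ μ *ᴿ f (suc k)) →
  ∀ k → f k ≈ᴿ solution μ (f 0) (f 1) k
solution-unique μ f rec k = proj₁ (go k)
  where
  f̂ = solution μ (f 0) (f 1)
  go : ∀ k → f k ≈ᴿ f̂ k × f (suc k) ≈ᴿ f̂ (suc k)
  go zero = R.refl , R.sym (solution-1 μ (f 0) (f 1))
  go (suc k) = let (p , q) = go k in q ,
    R.trans (step (rec k)) (R.trans (R.+-cong (R.*-congˡ q) (R.-‿cong p))
      (R.sym (step (solution-recurrence μ (f 0) (f 1) k))))

-- Eigenspaces of paths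

∑-++ : ∀ xs ys → ∑ (xs ++ ys) ≈ᴿ ∑ xs +ᴿ ∑ ys
∑-++ [] ys = R.sym (R.+-identityˡ _)
∑-++ (x ∷ xs) ys = R.trans (R.+-congˡ (∑-++ xs ys)) (R.sym (R.+-assoc _ _ _))

-- The sequence 0 , x 0 , … , x (n - 1) , 0 , 0 , …
pad : ∀ {n} → (Fin n → ℝ) → ℕ → ℝ
pad {n} x k = ∑ (map x (spot n k))

pad-toℕ : ∀ {n} (x : Fin n → ℝ) v → pad x (suc (toℕ v)) ≈ᴿ x v
pad-toℕ x v rewrite spot-toℕ v = R.+-identityʳ _

pad-> : ∀ {n} (x : Fin n → ℝ) → pad x (suc n) ≈ᴿ 0ℝ
pad-> {n} x rewrite spot-> n = R.refl

path-sum : ∀ n (x : Fin n → ℝ) u →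
  sum (λ v → adjacencyMatrix (path n) u v *ᴿ x v) ≈ᴿ pad x (toℕ u) +ᴿ pad x (2 + toℕ u)
path-sum n x u = R.trans (sum-neighbours (path n) u x (path-neighbours n u)) (R.trans
  (R.reflexive (cong ∑ (List.map-++ x (spot n (toℕ u)) (spot n (2 + toℕ u)))))
  (∑-++ (map x (spot n (toℕ u))) (map x (spot n (2 + toℕ u)))))

module _ (μ : ℝ) (n : ℕ) where

  private
    P = path (suc n)

    recurrence : ∀ {x} → IsEigenvector P μ x → ∀ {k} (u : Fin (suc n)) → toℕ u ≡ k →
      pad x k +ᴿ pad x (2 + k) ≈ᴿ μ *ᴿ pad x (suc k)
    recurrence {x} x∈ u ≡.refl =
      R.trans (R.sym (path-sum (suc n) x u)) (R.trans (x∈ u) (R.*-congˡ (R.sym (pad-toℕ x u))))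

    fromEnd : ∀ {x} → IsEigenvector P μ x → ∀ k → k ≤ suc n →
      pad x k ≈ᴿ s μ k *ᴿ x zero × pad x (suc k) ≈ᴿ s μ (suc k) *ᴿ x zero
    fromEnd {x} x∈ zero _ = R.sym (R.zeroˡ _) , R.trans (R.+-identityʳ _) (R.sym (R.*-identityˡ _))
    fromEnd {x} x∈ (suc k) k<n = let (p , q) = fromEnd x∈ k (ℕ.<⇒≤ k<n) in q , (begin
      pad x (2 + k)
        ≈⟨ step (recurrence x∈ (fromℕ< k<n) (Fin.toℕ-fromℕ< k<n)) ⟩
      μ *ᴿ pad x (suc k) R.- pad x k
        ≈⟨ R.+-cong (R.*-congˡ q) (R.-‿cong p) ⟩
      μ *ᴿ (s μ (suc k) *ᴿ x zero) R.- s μ k *ᴿ x zero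
        ≈⟨ solve 4 (λ μ y z x → μ :* (y :* x) :- z :* x := (μ :* y :- z) :* x) R.refl
             μ (s μ (suc k)) (s μ k) (x zero) ⟩
      s μ (2 + k) *ᴿ x zero ∎)

    pad-s : ∀ b → s μ (2 + n) *ᴿ b ≈ᴿ 0ℝ → ∀ k → k ≤ 2 + n →
      pad {suc n} (λ i → s μ (suc (toℕ i)) *ᴿ b) k ≈ᴿ s μ k *ᴿ b
    pad-s b end zero _ = R.sym (R.zeroˡ b)
    pad-s b end (suc k) (s≤s k≤) with k <? suc n
    ... | yes k<n rewrite Fin.toℕ-fromℕ< k<n = R.+-identityʳ _
    -- The index just past the last vertex: `pad` is empty there, and `end` makes the other side
    -- vanish too.
    ... | no  k≮n rewrite ℕ.≤-antisym k≤ (ℕ.≮⇒≥ k≮n) = R.sym end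

  -- With a zero placed beyond each end, the eigenvector equation is the recurrence of `s`. The left
  -- zero makes the vector a multiple of the Chebyshev sequence, with the first entry as factor; the
  -- right zero, at index `2 + n`, is the annihilation condition.
  eigenspace-path : Eigenspace P μ ≅ Ann (s μ (2 + n))
  eigenspace-path .to = reindex λ _ → zero
  eigenspace-path .from .ap y i = s μ (suc (toℕ i)) *ᴿ y tt
  eigenspace-path .from .cong≈ x≈y i = R.*-congˡ (x≈y tt)
  eigenspace-path .from .+-homo x y i = R.distribˡ _ _ _
  eigenspace-path .from .*-homo c x i =
    solve 3 (λ a c x → a :* (c :* x) := c :* (a :* x)) R.refl (s μ (suc (toℕ i))) c (x tt)
  eigenspace-path .to∈ {x} x∈ = R.trans (R.sym (proj₂ (fromEnd x∈ (suc n) ℕ.≤-refl))) (pad-> x)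
  eigenspace-path .from∈ {y} y∈ u = begin
    sum (λ v → adjacencyMatrix P u v *ᴿ x v)  ≈⟨ path-sum (suc n) x u ⟩
    pad x (toℕ u) +ᴿ pad x (2 + toℕ u)
      ≈⟨ R.+-cong (pad-s (y tt) y∈ _ (ℕ.<⇒≤ (ℕ.m<n⇒m<1+n (Fin.toℕ<n u)))) (pad-s (y tt) y∈ _ (s≤s (Fin.toℕ<n u))) ⟩
    s μ (toℕ u) *ᴿ y tt +ᴿ s μ (2 + toℕ u) *ᴿ y tt
      ≈⟨ solve 4 (λ μ y z x → z :* x :+ (μ :* y :- z) :* x := μ :* (y :* x)) R.refl
           μ (s μ (suc (toℕ u))) (s μ (toℕ u)) (y tt) ⟩
    μ *ᴿ x u ∎
    where
    x : Fin (suc n) → ℝ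
    x i = s μ (suc (toℕ i)) *ᴿ y tt
  eigenspace-path .from∘to {x} x∈ u = R.trans (R.sym (proj₂ (fromEnd x∈ (toℕ u) (ℕ.<⇒≤ (Fin.toℕ<n u))))) (pad-toℕ x u)
  eigenspace-path .to∘from _ _ = R.*-identityˡ _

-- Eigenspaces of cycles

module _ {n : ℕ} (3≤n : 3 ≤ n) {i j k : Fin n} (i⟶j : CyclicSuc i j) (j⟶k : CyclicSuc j k) where

  cycle-sum : ∀ x → sum (λ v → adjacencyMatrix (cycle n 3≤n) j v *ᴿ x v) ≈ᴿ x i +ᴿ x k
  cycle-sum x = R.trans (sum-neighbours (cycle n 3≤n) j x (cycle-neighbours 3≤n i⟶j j⟶k))
    (R.trans (R.+-congˡ (R.+-identityʳ _)) (R.+-comm _ _))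

-- f (2r) = f 0 and f (2r + 1) = f 1 amount to s_r (2 f 1 - μ f 0) = 0 and w s_r f 0 = 0, as
-- M²ʳ - 1 = s_r Mʳ (M - M⁻¹) for the transfer matrix M.
module Period (μ a b : ℝ) (j : ℕ) where

  r N : ℕ
  r = suc j
  N = r + r

  private
    W = s μ j
    X = s μ r
    Y = μ *ᴿ X R.- W

    S-1 : s μ (j + r) ≈ᴿ X *ᴿ X R.- W *ᴿ W
    S-1 = R.trans (R.reflexive (cong (s μ) (ℕ.+-suc j j))) (s-+ μ j j)

    S-0 : s μ N ≈ᴿ X *ᴿ Y R.- W *ᴿ X
    S-0 = s-+ μ j r

    S+1 : s μ (suc N) ≈ᴿ Y *ᴿ Y R.- X *ᴿ X
    S+1 = s-+ μ r r

    I = casoratian μ W X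

    normalise : ∀ x → I *ᴿ x ≈ᴿ x
    normalise x = R.trans (R.*-congʳ (s-casoratian μ j)) (R.*-identityˡ x)

  p t : ℝ
  p = X *ᴿ (2ℝ *ᴿ b R.- μ *ᴿ a)
  t = w μ *ᴿ X *ᴿ a

  fN fN+1 : ℝ
  fN   = solution μ a b N
  fN+1 = solution μ a b (suc N)

  private
    -- Let f be the solution, extended to index -1, and g k = X (f (k + 1) - f (k - 1)). Then `p` is
    -- g 0 and `q` is g 1. As f (k + r) - f (k - r) = g k, the defects f (2r) - f 0 and f (2r + 1) -
    -- f 1 are g r and g (r + 1), the combinations of `q` and `p` below.
    q : ℝ
    q = ½ℝ *ᴿ (μ *ᴿ p R.- t)

    fN≈ : fN ≈ᴿ a +ᴿ (X *ᴿ q R.- W *ᴿ p)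
    fN≈ = begin
      s μ N *ᴿ b R.- s μ (j + r) *ᴿ a
        ≈⟨ R.+-cong (R.*-congʳ S-0) (R.-‿cong (R.*-congʳ S-1)) ⟩
      (X *ᴿ Y R.- W *ᴿ X) *ᴿ b R.- (X *ᴿ X R.- W *ᴿ W) *ᴿ a
        ≈⟨ solve 5 (λ μ a b x w →
             let y = μ :* x :- w
                 p = x :* (con (1ℚ ℚ.+ 1ℚ) :* b :- μ :* a)
                 t = (con ((1ℚ ℚ.+ 1ℚ) ℚ.+ (1ℚ ℚ.+ 1ℚ)) :- μ :* μ) :* x :* a
                 q = con ½ :* (μ :* p :- t)
             in (x :* y :- w :* x) :* b :- (x :* x :- w :* w) :* a :=
                ((x :* x :- μ :* (w :* x)) :+ w :* w) :* a :+ (x :* q :- w :* p)) R.refl μ a b X W ⟩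
      I *ᴿ a +ᴿ (X *ᴿ q R.- W *ᴿ p)
        ≈⟨ R.+-congʳ (normalise a) ⟩
      a +ᴿ (X *ᴿ q R.- W *ᴿ p) ∎

    fN+1≈ : fN+1 ≈ᴿ b +ᴿ (Y *ᴿ q R.- X *ᴿ p)
    fN+1≈ = begin
      s μ (suc N) *ᴿ b R.- s μ N *ᴿ a
        ≈⟨ R.+-cong (R.*-congʳ S+1) (R.-‿cong (R.*-congʳ S-0)) ⟩
      (Y *ᴿ Y R.- X *ᴿ X) *ᴿ b R.- (X *ᴿ Y R.- W *ᴿ X) *ᴿ a
        ≈⟨ solve 5 (λ μ a b x w →
             let y = μ :* x :- w
                 p = x :* (con (1ℚ ℚ.+ 1ℚ) :* b :- μ :* a)
                 t = (con ((1ℚ ℚ.+ 1ℚ) ℚ.+ (1ℚ ℚ.+ 1ℚ)) :- μ :* μ) :* x :* a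
                 q = con ½ :* (μ :* p :- t)
             in (y :* y :- x :* x) :* b :- (x :* y :- w :* x) :* a :=
                ((x :* x :- μ :* (w :* x)) :+ w :* w) :* b :+ (y :* q :- x :* p)) R.refl μ a b X W ⟩
      I *ᴿ b +ᴿ (Y *ᴿ q R.- X *ᴿ p)
        ≈⟨ R.+-congʳ (normalise b) ⟩
      b +ᴿ (Y *ᴿ q R.- X *ᴿ p) ∎

    diff : ∀ {x y z} → x ≈ᴿ y +ᴿ z → x ≈ᴿ y → z ≈ᴿ 0ℝ
    diff {x} {y} {z} x≈y+z x≈y = begin
      z               ≈⟨ solve 2 (λ y z → z := (y :+ z) :- y) R.refl y z ⟩
      (y +ᴿ z) R.- y  ≈⟨ R.+-cong (R.sym x≈y+z) (R.-‿cong (R.sym x≈y)) ⟩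
      x R.- x         ≈⟨ R.-‿inverseʳ x ⟩
      0ℝ              ∎

  module _ (fN≈a : fN ≈ᴿ a) (fN+1≈b : fN+1 ≈ᴿ b) where

    private
      α = diff fN≈ fN≈a
      β = diff fN+1≈ fN+1≈b

    -- The determinant of the two defects as linear forms in `p` and `q` is `I` up to sign, hence
    -- invertible. Cramer's rule recovers `p` here and `q` next, without division.
    p≈0 : p ≈ᴿ 0ℝ
    p≈0 = begin
      p       ≈⟨ normalise p ⟨
      I *ᴿ p  ≈⟨ solve 5 (λ μ x w p q → let y = μ :* x :- w in
                   ((x :* x :- μ :* (w :* x)) :+ w :* w) :* p :=
                   y :* (x :* q :- w :* p) :- x :* (y :* q :- x :* p)) R.refl μ X W p q ⟩
      Y *ᴿ (X *ᴿ q R.- W *ᴿ p) R.- X *ᴿ (Y *ᴿ q R.- X *ᴿ p)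
              ≈⟨ R.+-cong (R.*-congˡ α) (R.-‿cong (R.*-congˡ β)) ⟩
      Y *ᴿ 0ℝ R.- X *ᴿ 0ℝ
              ≈⟨ solve 2 (λ x y → y :* con 0ℚ :- x :* con 0ℚ := con 0ℚ) R.refl X Y ⟩
      0ℝ ∎

    q≈0 : q ≈ᴿ 0ℝ
    q≈0 = begin
      q       ≈⟨ normalise q ⟨
      I *ᴿ q  ≈⟨ solve 5 (λ μ x w p q → let y = μ :* x :- w in
                   ((x :* x :- μ :* (w :* x)) :+ w :* w) :* q :=
                   x :* (x :* q :- w :* p) :- w :* (y :* q :- x :* p)) R.refl μ X W p q ⟩
      X *ᴿ (X *ᴿ q R.- W *ᴿ p) R.- W *ᴿ (Y *ᴿ q R.- X *ᴿ p)
              ≈⟨ R.+-cong (R.*-congˡ α) (R.-‿cong (R.*-congˡ β)) ⟩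
      X *ᴿ 0ℝ R.- W *ᴿ 0ℝ
              ≈⟨ solve 2 (λ x w → x :* con 0ℚ :- w :* con 0ℚ := con 0ℚ) R.refl X W ⟩
      0ℝ ∎

    t≈0 : t ≈ᴿ 0ℝ
    t≈0 = begin
      t                     ≈⟨ solve 3 (λ μ p t → t := μ :* p :- con (1ℚ ℚ.+ 1ℚ) :* (con ½ :* (μ :* p :- t))) R.refl μ p t ⟩
      μ *ᴿ p R.- 2ℝ *ᴿ q    ≈⟨ R.+-cong (R.*-congˡ p≈0) (R.-‿cong (R.*-congˡ q≈0)) ⟩
      μ *ᴿ 0ℝ R.- 2ℝ *ᴿ 0ℝ  ≈⟨ solve 1 (λ μ → μ :* con 0ℚ :- con (1ℚ ℚ.+ 1ℚ) :* con 0ℚ := con 0ℚ) R.refl μ ⟩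
      0ℝ                    ∎

  module _ (p≈0 : p ≈ᴿ 0ℝ) (t≈0 : t ≈ᴿ 0ℝ) where

    private
      q≈0′ : q ≈ᴿ 0ℝ
      q≈0′ = R.trans (R.*-congˡ (R.+-cong (R.*-congˡ p≈0) (R.-‿cong t≈0)))
        (solve 1 (λ μ → con ½ :* (μ :* con 0ℚ :- con 0ℚ) := con 0ℚ) R.refl μ)

      vanish : ∀ x y z → x +ᴿ (y *ᴿ q R.- z *ᴿ p) ≈ᴿ x
      vanish x y z = R.trans (R.+-congˡ (R.+-cong (R.*-congˡ q≈0′) (R.-‿cong (R.*-congˡ p≈0))))
        (solve 3 (λ x y z → x :+ (y :* con 0ℚ :- z :* con 0ℚ) := x) R.refl x y z)

    fN≈a : fN ≈ᴿ a
    fN≈a = R.trans fN≈ (vanish a X W)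

    fN+1≈b : fN+1 ≈ᴿ b
    fN+1≈b = R.trans fN+1≈ (vanish b Y X)

-- Unrolls the cycle onto ℕ. An eigenvector becomes a sequence that satisfies the recurrence at
-- every index, so `solution-unique` applies with no case distinction at the wrap-around.
around : ∀ {n} → ℕ → Fin (suc n)
around zero    = zero
around (suc k) = proj₁ (next (around k))

around-suc : ∀ {n} k → CyclicSuc {suc n} (around k) (around (suc k))
around-suc k = proj₂ (next (around k))

toℕ-around : ∀ {n k} → k < suc n → toℕ (around {n} k) ≡ k
toℕ-around {k = zero} _ = ≡.refl
toℕ-around {n} {suc k} k<n with around-suc {n} k
... | inj₁ p = ≡.trans (≡.sym p) (cong suc (toℕ-around (ℕ.<⇒≤ k<n)))
... | inj₂ (p , _) = contradiction (≡.trans (cong suc (≡.sym (toℕ-around (ℕ.<⇒≤ k<n)))) p) (ℕ.<⇒≢ k<n)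

around-toℕ : ∀ {n} (i : Fin (suc n)) → around (toℕ i) ≡ i
around-toℕ i = Fin.toℕ-injective (toℕ-around (Fin.toℕ<n i))

around-n : ∀ n → around {n} (suc n) ≡ zero
around-n n with around-suc {n} n
... | inj₁ p = contradiction (≡.trans (≡.sym p) (cong suc (toℕ-around {n} (ℕ.n<1+n n))))
  (ℕ.<⇒≢ (Fin.toℕ<n (around {n} (suc n))))
... | inj₂ (_ , p) = Fin.toℕ-injective p

module _ (μ : ℝ) (j : ℕ) (3≤N : 3 ≤ suc j + suc j) where

  private
    n = j + suc j
    C = cycle (suc n) 3≤N
    module P a b = Period μ a b j

    v₁ : Fin (suc n)
    v₁ = around 1

    around-solution : ∀ {x} → IsEigenvector C μ x → ∀ k → x (around k) ≈ᴿ solution μ (x zero) (x v₁) k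
    around-solution {x} x∈ = solution-unique μ (x ∘ around) λ k →
      R.trans (R.sym (cycle-sum 3≤N (around-suc k) (around-suc (suc k)) x)) (x∈ (around (suc k)))

    restrict-eigen : ∀ a b → P.fN a b ≈ᴿ a → P.fN+1 a b ≈ᴿ b →
      IsEigenvector C μ (solution μ a b ∘ toℕ)
    restrict-eigen a b fN≈a fN+1≈b v with (i , i⟶v) ← prev v | (k , v⟶k) ← next v =
      R.trans (cycle-sum 3≤N i⟶v v⟶k (f ∘ toℕ)) (three i⟶v v⟶k)
      where
      f = solution μ a b
      rec = solution-recurrence μ a b
      three : ∀ {i v k : Fin (suc n)} → CyclicSuc i v → CyclicSuc v k → f (toℕ i) +ᴿ f (toℕ k) ≈ᴿ μ *ᴿ f (toℕ v)
      three {i} {v} {k} (inj₁ p) (inj₁ q) rewrite ≡.sym q | ≡.sym p = rec (toℕ i)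
      three {i} {v} {k} (inj₁ p) (inj₂ (q , r)) = begin
        f (toℕ i) +ᴿ f (toℕ k)        ≈⟨ R.+-congˡ (value f r) ⟩
        f (toℕ i) +ᴿ f 0              ≈⟨ R.+-congˡ fN≈a ⟨
        f (toℕ i) +ᴿ f (suc n)        ≈⟨ R.+-congˡ (value f (≡.trans (cong suc p) q)) ⟨
        f (toℕ i) +ᴿ f (2 + toℕ i)    ≈⟨ rec (toℕ i) ⟩
        μ *ᴿ f (suc (toℕ i))          ≈⟨ R.*-congˡ (value f p) ⟩
        μ *ᴿ f (toℕ v)                ∎
      -- At vertex 0 the recurrence is used one period later, around index `suc n`, and both
      -- periodicity conditions bring the values back.
      three {i} {v} {k} (inj₂ (p , q)) (inj₁ r) = begin
        f (toℕ i) +ᴿ f (toℕ k)        ≈⟨ R.+-congˡ (value f (≡.trans (≡.sym r) (cong suc q))) ⟩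
        f (toℕ i) +ᴿ f 1              ≈⟨ R.+-congˡ (solution-1 μ a b) ⟩
        f (toℕ i) +ᴿ b                ≈⟨ R.+-congˡ fN+1≈b ⟨
        f (toℕ i) +ᴿ f (2 + n)        ≈⟨ R.+-congˡ (value f (cong suc p)) ⟨
        f (toℕ i) +ᴿ f (2 + toℕ i)    ≈⟨ rec (toℕ i) ⟩
        μ *ᴿ f (suc (toℕ i))          ≈⟨ R.*-congˡ (value f p) ⟩
        μ *ᴿ f (suc n)                ≈⟨ R.*-congˡ fN≈a ⟩
        μ *ᴿ f 0                      ≈⟨ R.*-congˡ (value f q) ⟨
        μ *ᴿ f (toℕ v)                ∎
      three {i} {v} {k} (inj₂ (p , q)) (inj₂ (r , _)) =
        contradiction (≡.trans (cong suc (≡.sym q)) r) (ℕ.<⇒≢ (ℕ.<-trans (s≤s (s≤s z≤n)) 3≤N))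

    lift : ℝ → ℝ → ℝ
    lift a o = ½ℝ *ᴿ (o +ᴿ μ *ᴿ a)

    2-lift : ∀ a o → 2ℝ *ᴿ lift a o R.- μ *ᴿ a ≈ᴿ o
    2-lift = solve 3 (λ μ a o → con (1ℚ ℚ.+ 1ℚ) :* (con ½ :* (o :+ μ :* a)) :- μ :* a := o) R.refl μ

    lift-2 : ∀ a b → lift a (2ℝ *ᴿ b R.- μ *ᴿ a) ≈ᴿ b
    lift-2 = solve 3 (λ μ a b → con ½ :* ((con (1ℚ ℚ.+ 1ℚ) :* b :- μ :* a) :+ μ :* a) := b) R.refl μ

  -- For an eigenvector the second coordinate is the difference of the entries at the two neighbours
  -- of vertex 0. The coordinates thus separate the even and the odd part under reflection at that
  -- vertex, and in them the two conditions of `Period` decouple; `lift` recovers `x v₁`.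
  eigenspace-cycle : Eigenspace C μ ≅ (Ann (w μ *ᴿ s μ (suc j)) ⊕ Ann (s μ (suc j)))
  eigenspace-cycle .to .ap x (inj₁ _) = x zero
  eigenspace-cycle .to .ap x (inj₂ _) = 2ℝ *ᴿ x v₁ R.- μ *ᴿ x zero
  eigenspace-cycle .to .cong≈ x≈y (inj₁ _) = x≈y zero
  eigenspace-cycle .to .cong≈ x≈y (inj₂ _) = R.+-cong (R.*-congˡ (x≈y v₁)) (R.-‿cong (R.*-congˡ (x≈y zero)))
  eigenspace-cycle .to .+-homo x y (inj₁ _) = R.refl
  eigenspace-cycle .to .+-homo x y (inj₂ _) =
    solve 6 (λ c μ a b a′ b′ → c :* (b :+ b′) :- μ :* (a :+ a′) := (c :* b :- μ :* a) :+ (c :* b′ :- μ :* a′)) R.refl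
      2ℝ μ (x zero) (x v₁) (y zero) (y v₁)
  eigenspace-cycle .to .*-homo c x (inj₁ _) = R.refl
  eigenspace-cycle .to .*-homo c x (inj₂ _) =
    solve 5 (λ d μ c a b → d :* (c :* b) :- μ :* (c :* a) := c :* (d :* b :- μ :* a)) R.refl
      2ℝ μ c (x zero) (x v₁)
  eigenspace-cycle .from .ap y i = solution μ (y (inj₁ tt)) (lift (y (inj₁ tt)) (y (inj₂ tt))) (toℕ i)
  eigenspace-cycle .from .cong≈ x≈y i = solution-cong μ (x≈y (inj₁ tt))
    (R.*-congˡ (R.+-cong (x≈y (inj₂ tt)) (R.*-congˡ (x≈y (inj₁ tt))))) (toℕ i)
  eigenspace-cycle .from .+-homo x y i = R.trans
    (solution-cong μ R.refl (solve 6 (λ h μ a b a′ b′ → h :* ((b :+ b′) :+ μ :* (a :+ a′)) :=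
       h :* (b :+ μ :* a) :+ h :* (b′ :+ μ :* a′)) R.refl
       ½ℝ μ (x (inj₁ tt)) (x (inj₂ tt)) (y (inj₁ tt)) (y (inj₂ tt))) (toℕ i))
    (solution-+ μ _ _ _ _ (toℕ i))
  eigenspace-cycle .from .*-homo c x i = R.trans
    (solution-cong μ R.refl (solve 5 (λ h μ c a b → h :* (c :* b :+ μ :* (c :* a)) := c :* (h :* (b :+ μ :* a))) R.refl
       ½ℝ μ c (x (inj₁ tt)) (x (inj₂ tt))) (toℕ i))
    (solution-* μ c _ _ (toℕ i))
  eigenspace-cycle .to∈ {x} x∈ = P.t≈0 _ _ fN≈a fN+1≈b , P.p≈0 _ _ fN≈a fN+1≈b
    where
    fN≈a : P.fN (x zero) (x v₁) ≈ᴿ x zero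
    fN≈a = R.trans (R.sym (around-solution x∈ (suc n))) (value x (around-n n))
    fN+1≈b : P.fN+1 (x zero) (x v₁) ≈ᴿ x v₁
    fN+1≈b = R.trans (R.sym (around-solution x∈ (2 + n))) (value x (cong (proj₁ ∘ next) (around-n n)))
  eigenspace-cycle .from∈ {y} (t≈0 , o≈0) = restrict-eigen _ _ (P.fN≈a _ _ p≈0 t≈0) (P.fN+1≈b _ _ p≈0 t≈0)
    where
    p≈0 : P.p (y (inj₁ tt)) (lift (y (inj₁ tt)) (y (inj₂ tt))) ≈ᴿ 0ℝ
    p≈0 = R.trans (R.*-congˡ (2-lift _ _)) o≈0
  eigenspace-cycle .from∘to {x} x∈ i = begin
    solution μ (x zero) (lift (x zero) (2ℝ *ᴿ x v₁ R.- μ *ᴿ x zero)) (toℕ i)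
      ≈⟨ solution-cong μ R.refl (lift-2 (x zero) (x v₁)) (toℕ i) ⟩
    solution μ (x zero) (x v₁) (toℕ i)  ≈⟨ around-solution x∈ (toℕ i) ⟨
    x (around (toℕ i))                  ≈⟨ value x (around-toℕ i) ⟩
    x i                                 ∎
  eigenspace-cycle .to∘from _ (inj₁ _) = R.refl
  eigenspace-cycle .to∘from {y} _ (inj₂ _) = R.trans
    (R.+-congʳ (R.*-congˡ (R.trans
      (value (solution μ (y (inj₁ tt)) _) (toℕ-around {n} (ℕ.<-trans (s≤s (s≤s z≤n)) 3≤N)))
      (solution-1 μ (y (inj₁ tt)) _))))
    (2-lift (y (inj₁ tt)) (y (inj₂ tt)))

-- The exchange of cycles and paths

module _ (μ : ℝ) (k : ℕ) where

  private
    X = s μ k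
    V = v μ k

    quarter : ∀ {x y} → x +ᴿ y ≈ᴿ 4ℝ → ¼ℝ *ᴿ (x +ᴿ y) ≈ᴿ 1ℝ
    quarter eq = R.trans (R.*-congˡ eq) (solve 0 (con (½ ℚ.* ½) :* con ((1ℚ ℚ.+ 1ℚ) ℚ.+ (1ℚ ℚ.+ 1ℚ)) := con 1ℚ) R.refl)

  split-s : Ann (s μ (k + k)) ≅ (Ann X ⊕ Ann V)
  split-s = ≅-trans (Ann-cong (s-double μ k)) (Ann-* X V (¼ℝ *ᴿ w μ *ᴿ X) (¼ℝ *ᴿ V) (R.trans
    (solve 4 (λ c w x v → c :* w :* x :* x :+ c :* v :* v := c :* (v :* v :+ w :* (x :* x))) R.refl ¼ℝ (w μ) X V)
    (quarter (pythagoras μ k))))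

  -- The Bézout relation of `split-s` again, with `w μ` moved from the cofactor into the element.
  split-ws : Ann (w μ *ᴿ s μ (k + k)) ≅ (Ann (w μ *ᴿ X) ⊕ Ann V)
  split-ws = ≅-trans (Ann-cong (R.trans (R.*-congˡ (s-double μ k)) (R.sym (R.*-assoc (w μ) X V))))
    (Ann-* (w μ *ᴿ X) V (¼ℝ *ᴿ X) (¼ℝ *ᴿ V) (R.trans
    (solve 4 (λ c w x v → c :* x :* (w :* x) :+ c :* v :* v := c :* (v :* v :+ w :* (x :* x))) R.refl ¼ℝ (w μ) X V)
    (quarter (pythagoras μ k))))

  -- It is enough to split one copy of `Ann (s μ (k + k))` on the left and the summand with the
  -- factor `w μ` on the right. Then both sides consist of `Ann (w μ *ᴿ X)`, two copies of `Ann X`,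
  -- `Ann V` and `Ann (s μ (k + k))`.
  exchange : ((Ann (w μ *ᴿ X) ⊕ Ann X) ⊕ (Ann (s μ (k + k)) ⊕ Ann (s μ (k + k)))) ≅
             ((Ann (w μ *ᴿ s μ (k + k)) ⊕ Ann (s μ (k + k))) ⊕ (Ann X ⊕ Ann X))
  exchange = ≅-trans (⊕-cong ≅-refl (⊕-cong split-s ≅-refl))
    (≅-trans permute (≅-sym (⊕-cong (⊕-cong split-ws ≅-refl) ≅-refl)))
    where
    permute : ∀ {A B C D} → ((A ⊕ B) ⊕ ((B ⊕ C) ⊕ D)) ≅ (((A ⊕ C) ⊕ D) ⊕ (B ⊕ B))
    permute .to = reindex λ
      { (inj₁ (inj₁ (inj₁ a))) → inj₁ (inj₁ a)
      ; (inj₁ (inj₁ (inj₂ c))) → inj₂ (inj₁ (inj₂ c))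
      ; (inj₁ (inj₂ d)) → inj₂ (inj₂ d)
      ; (inj₂ (inj₁ b)) → inj₁ (inj₂ b)
      ; (inj₂ (inj₂ b)) → inj₂ (inj₁ (inj₁ b)) }
    permute .from = reindex λ
      { (inj₁ (inj₁ a)) → inj₁ (inj₁ (inj₁ a))
      ; (inj₁ (inj₂ b)) → inj₂ (inj₁ b)
      ; (inj₂ (inj₁ (inj₁ b))) → inj₂ (inj₂ b)
      ; (inj₂ (inj₁ (inj₂ c))) → inj₁ (inj₁ (inj₂ c))
      ; (inj₂ (inj₂ d)) → inj₁ (inj₂ d) }
    permute .to∈ ((a∈ , b∈) , (b∈′ , c∈) , d∈) = ((a∈ , c∈) , d∈) , b∈ , b∈′
    permute .from∈ (((a∈ , c∈) , d∈) , b∈ , b∈′) = (a∈ , b∈) , (b∈′ , c∈) , d∈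
    permute .from∘to _ = λ
      { (inj₁ (inj₁ _)) → R.refl ; (inj₁ (inj₂ _)) → R.refl ; (inj₂ (inj₁ (inj₁ _))) → R.refl
      ; (inj₂ (inj₁ (inj₂ _))) → R.refl ; (inj₂ (inj₂ _)) → R.refl }
    permute .to∘from _ = λ
      { (inj₁ (inj₁ (inj₁ _))) → R.refl ; (inj₁ (inj₁ (inj₂ _))) → R.refl ; (inj₁ (inj₂ _)) → R.refl
      ; (inj₂ (inj₁ _)) → R.refl ; (inj₂ (inj₂ _)) → R.refl }

eigenspace-cycle∪paths : ∀ μ j m 3≤n → Eigenspace (cycle∪paths (suc j + suc j) 3≤n (suc m)) μ ≅
  ((Ann (w μ *ᴿ s μ (suc j)) ⊕ Ann (s μ (suc j))) ⊕ (Ann (s μ (2 + m)) ⊕ Ann (s μ (2 + m))))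
eigenspace-cycle∪paths μ j m 3≤n = ≅-trans (eigenspace-∪ _ _ μ) (⊕-cong (eigenspace-cycle μ j 3≤n)
  (≅-trans (eigenspace-∪ _ _ μ) (⊕-cong (eigenspace-path μ m) (eigenspace-path μ m))))

-- The paths have orders 2p - 1 and p - 1, so they contribute the elements with indices 2p and p:
-- each the one that belongs to the cycle of the other graph.
similar-exchange : ∀ j (let p = 2 + j) 3≤2p 3≤4p →
  SimilarGraphs (cycle∪paths (p + p) 3≤2p (suc j + p)) (cycle∪paths ((p + p) + (p + p)) 3≤4p (suc j))
similar-exchange j 3≤2p 3≤4p μ = ≅-trans (eigenspace-cycle∪paths μ (suc j) (j + (2 + j)) 3≤2p)
  (≅-trans (exchange μ (2 + j)) (≅-sym (eigenspace-cycle∪paths μ (suc j + (2 + j)) j 3≤4p)))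

-- The greedy construction

-- The invariant after `t` steps: the half-lengths from 4 to `3 + t` are settled. `Irregular` and
-- `SimilarGraphs` replace the notions of the theorem because they pass directly to disjoint unions.
-- Counts are kept as functions of the length, so that the next comparison can be decided.
record Pair (t : ℕ) : Set where
  field
    {D D′}       : Graph
    irregular    : Irregular D
    irregular′   : Irregular D′
    similar      : SimilarGraphs D D′
    {σ}          : Vertex D → Bool
    {σ′}         : Vertex D′ → Bool
    bipartition  : IsBipartition D σ
    bipartition′ : IsBipartition D′ σ′
    degrees      : ∀ b → sideDegrees D σ b ↭ sideDegrees D′ σ′ b
    girth        : GirthAtLeast 6 D
    girth′       : GirthAtLeast 6 D′
    {N N′}       : ℕ → ℕ
    counted      : CountedBy D N
    counted′     : CountedBy D′ N′
    one-6-cycle  : N 6 ≡ 1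
    one-6-cycle′ : N′ 6 ≡ 1
    differ       : ∀ p → 4 ≤ p → p ≤ 3 + t → N (p + p) ≢ N′ (p + p)

base : Pair 0
base = record
  { irregular    = irr
  ; irregular′   = irr
  ; similar      = λ μ → ≅-refl
  ; bipartition  = bip
  ; bipartition′ = bip
  ; degrees      = λ b → ↭-refl
  ; girth        = gir
  ; girth′       = gir
  ; counted      = cou
  ; counted′     = cou
  ; one-6-cycle  = ≡.refl
  ; one-6-cycle′ = ≡.refl
  ; differ       = λ p 4≤p p≤3 → contradiction p≤3 (ℕ.<⇒≱ 4≤p)
  }
  where
  3≤6 : 3 ≤ 6
  3≤6 = s≤s (s≤s (s≤s z≤n))
  C = cycle 6 3≤6
  P = path 5
  irr : Irregular (C ∪ P)
  irr = irregular-ʳ C P (zero , suc zero , suc (suc zero) , ≡.refl , ≡.refl , λ ())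
  bip = bipartition-∪ C P (parity-cycle 3 3≤6) (parity-path 5)
  gir : GirthAtLeast 6 (C ∪ P)
  gir = girth-∪ C P (girth-cycle 6 3≤6 ℕ.≤-refl) (girth-path 5)
  cou : CountedBy (C ∪ P) (λ k → δ 6 k + 0)
  cou k = count-∪ C P (counted-cycle 6 3≤6 k) (count-0 (path-acyclic 5))

module Extend {t : ℕ} (pair : Pair t) where
  open Pair pair

  p = 4 + t

  3≤2p : 3 ≤ p + p
  3≤2p = s≤s (s≤s (s≤s z≤n))

  3≤4p : 3 ≤ (p + p) + (p + p)
  3≤4p = s≤s (s≤s (s≤s z≤n))

  E E′ : Graph
  E  = cycle∪paths (p + p) 3≤2p (3 + t + p)
  E′ = cycle∪paths ((p + p) + (p + p)) 3≤4p (3 + t)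

  τ : Vertex E → Bool
  τ = cycle∪paths-side (p + p) 3≤2p (3 + t + p)

  τ′ : Vertex E′ → Bool
  τ′ = cycle∪paths-side ((p + p) + (p + p)) 3≤4p (3 + t)

  degrees-E : ∀ b → sideDegrees E τ b ↭ sideDegrees E′ τ′ b
  degrees-E b = ↭-trans
    (sideDegrees-cycle∪paths p 3≤2p {m = suc t + p} ≡.refl (count₁ t) b)
    (↭-sym (sideDegrees-cycle∪paths (p + p) 3≤4p {m = suc t} ≡.refl (count₂ t) b))
    where
    count₁ : ∀ t → (4 + t) + (suc t + (4 + t)) ≡ 9 + (t + t + t)
    count₁ = solve-∀
    count₂ : ∀ t → ((4 + t) + (4 + t)) + suc t ≡ 9 + (t + t + t)
    count₂ = solve-∀

  new : ∀ (M : ℕ → ℕ) n {k} → k < n → M k + (δ n k + 0) ≡ M k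
  new M n {k} k<n rewrite δ-≢ (ℕ.<⇒≢ k<n) = ℕ.+-identityʳ (M k)

  p<p+p : ∀ {p} → 4 ≤ p → p < p + p
  p<p+p {p} 4≤p = ℕ.m<m+n p (ℕ.≤-trans (s≤s z≤n) 4≤p)

  2p<4p : p + p < (p + p) + (p + p)
  2p<4p = p<p+p {p + p} (ℕ.≤-trans (s≤s (s≤s (s≤s (s≤s z≤n)))) (ℕ.m≤m+n p p))

  6<2p : 6 < p + p
  6<2p = ℕ.≤-trans (ℕ.n≤1+n 7) (ℕ.+-mono-≤ (ℕ.m≤m+n 4 t) (ℕ.m≤m+n 4 t))

  6<4p : 6 < (p + p) + (p + p)
  6<4p = ℕ.<-trans 6<2p 2p<4p

  extend : N (p + p) ≡ N′ (p + p) → Pair (suc t)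
  extend equal = record
    { D            = D ∪ E
    ; D′           = D′ ∪ E′
    ; irregular    = irregular-ˡ D E irregular
    ; irregular′   = irregular-ˡ D′ E′ irregular′
    ; similar      = similar-∪ {D} {D′} {E} {E′} similar (similar-exchange (2 + t) 3≤2p 3≤4p)
    ; bipartition  = bipartition-∪ D E bipartition (cycle∪paths-bipartition p 3≤2p (3 + t + p))
    ; bipartition′ = bipartition-∪ D′ E′ bipartition′ (cycle∪paths-bipartition (p + p) 3≤4p (3 + t))
    ; degrees      = λ b → ↭-trans (↭-reflexive (sideDegrees-∪ D E σ τ b))
                       (↭-trans (++⁺ (degrees b) (degrees-E b)) (↭-reflexive (≡.sym (sideDegrees-∪ D′ E′ σ′ τ′ b))))
    ; girth        = girth-∪ D E girth (girth-cycle∪paths (p + p) 3≤2p (3 + t + p) (ℕ.<⇒≤ 6<2p))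
    ; girth′       = girth-∪ D′ E′ girth′ (girth-cycle∪paths ((p + p) + (p + p)) 3≤4p (3 + t) (ℕ.<⇒≤ 6<4p))
    ; counted      = λ k → count-∪ D E (counted k) (counted-cycle∪paths (p + p) 3≤2p (3 + t + p) k)
    ; counted′     = λ k → count-∪ D′ E′ (counted′ k) (counted-cycle∪paths ((p + p) + (p + p)) 3≤4p (3 + t) k)
    ; one-6-cycle  = ≡.trans (new N (p + p) 6<2p) one-6-cycle
    ; one-6-cycle′ = ≡.trans (new N′ ((p + p) + (p + p)) 6<4p) one-6-cycle′
    ; differ       = differ′
    }
    where
    differ′ : ∀ q → 4 ≤ q → q ≤ p → N (q + q) + (δ (p + p) (q + q) + 0) ≢ N′ (q + q) + (δ ((p + p) + (p + p)) (q + q) + 0)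
    differ′ q 4≤q q≤p with ℕ.m≤n⇒m<n∨m≡n q≤p
    -- Both new cycles are longer than 2q, so the earlier difference persists.
    ... | inj₁ (s≤s q≤3+t) = λ e → differ q 4≤q q≤3+t
      (≡.trans (≡.sym (new N (p + p) 2q<2p)) (≡.trans e (new N′ ((p + p) + (p + p)) (ℕ.<-trans 2q<2p 2p<4p))))
      where 2q<2p = ℕ.+-mono-< (s≤s q≤3+t) (s≤s q≤3+t)
    ... | inj₂ ≡.refl = λ e → ℕ.1+n≢n (≡.trans (≡.sym one-more) (≡.trans e
      (≡.trans (new N′ ((p + p) + (p + p)) 2p<4p) (≡.sym equal))))
      where
      one-more : N (p + p) + (δ (p + p) (p + p) + 0) ≡ suc (N (p + p))
      one-more = ≡.trans (cong (λ d → N (p + p) + (d + 0)) (δ-≡ (p + p))) (ℕ.+-comm (N (p + p)) 1)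

  keep : N (p + p) ≢ N′ (p + p) → Pair (suc t)
  keep unequal = record
    { Pair pair
    ; differ = λ q 4≤q q≤p → [ (λ { (s≤s q≤3+t) → differ q 4≤q q≤3+t }) , (λ { ≡.refl → unequal }) ]
        (ℕ.m≤n⇒m<n∨m≡n q≤p)
    }

pairs : ∀ t → Pair t
pairs zero = base
pairs (suc t) with pair ← pairs t with Pair.N pair ((4 + t) + (4 + t)) ≟ Pair.N′ pair ((4 + t) + (4 + t))
... | yes equal  = Extend.extend pair equal
... | no unequal = Extend.keep pair unequal

mainTheorem6 : ∀ (i : ℕ) → 1 ≤ i →
    Σ[ D ∈ Graph ] Σ[ D′ ∈ Graph ]
    ( IrregularBipartite D × IrregularBipartite D′
    × SameSpectrum D D′
    × SameDegreeSequences D D′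
    × HasGirth D 6 × HasGirth D′ 6
    × CycleCount D 6 1 × CycleCount D′ 6 1
    × (∀ k → 2 ∣ k → 6 < k → k ≤ 2 * i + 10 →
    ∃₂ λ N N′ → CycleCount D k N × CycleCount D′ k N′ × N ≢ N′) )
mainTheorem6 i _ = D , D′ ,
  ((σ , bipartition) , irregular⇒¬biRegular {D} irregular) ,
  ((σ′ , bipartition′) , irregular⇒¬biRegular {D′} irregular′) ,
  similar⇒sameSpectrum {D} {D′} similar ,
  (σ , σ′ , bipartition , bipartition′ , λ b → sort-cong (degrees b)) ,
  (from-count one , girth) , (from-count one′ , girth′) ,
  one , one′ ,
  λ { k (divides q ≡.refl) 6<k k≤ → N k , N′ k , counted k , counted′ k ,
      subst (λ k → N k ≢ N′ k) (≡.sym (double q)) (differ q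
        (ℕ.*-cancelʳ-< 2 3 q 6<k)
        (ℕ.*-cancelʳ-≤ q (5 + i) 2 (ℕ.≤-trans k≤ (ℕ.≤-reflexive (bound i))))) }
  where
  -- The settled half-lengths then reach 3 + (2 + i) = i + 5, half of the bound 2i + 10.
  open Pair (pairs (2 + i))
  one : CycleCount D 6 1
  one = subst (CycleCount D 6) one-6-cycle (counted 6)
  one′ : CycleCount D′ 6 1
  one′ = subst (CycleCount D′ 6) one-6-cycle′ (counted′ 6)
  from-count : ∀ {G k N} → CycleCount G k (suc N) → Cycle G k
  from-count I = Inverse.from I zero
  double : ∀ q → q * 2 ≡ q + q
  double q = ≡.trans (ℕ.*-comm q 2) (cong (q +_) (ℕ.+-identityʳ q))
  bound : ∀ i → 2 * i + 10 ≡ (5 + i) * 2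
  bound = solve-∀
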